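{- Let $n$ and $r$ be positive integers. Then: (a) $La(n,\bigvee,P_2)=La(n,\bigwedge,P_2)=\binom{n}{\lfloor n/2\rfloor}$. (b) $La(n,\{\bigvee,\bigwedge\},P_2)=\binom{n-1}{\lfloor (n-1)/2\rfloor}$. (c) $La(n,B,D_r)=\binom{\binom{n}{\lfloor n/2\rfloor}}{r}$. (d) $La(n,\bigvee,\bigwedge_r)=La(n,\bigwedge,\bigvee_r)=\binom{\binom{n}{\lfloor n/2\rfloor}}{r}$.
   Context: $[n]=\{1,\dots,n\}$, and $2^{[n]}$ is the family of all subsets of $[n]$. For a finite poset $P$ and a family $\mathcal{F}$ of sets, a subfamily $\mathcal{G}\subseteq\mathcal{F}$ is a copy of $P$ in $\mathcal{F}$ if there is a bijection $\phi:P\to\mathcal{G}$ such that $x\le_P x'$ implies $\phi(x)\subseteq\phi(x')$ (the converse implication is not required). $c(P,\mathcal{F})$ denotes the number of copies of $P$ in $\mathcal{F}$ (i.e. the number of such subfamilies $\mathcal{G}$). For posets $P,Q$, $La(n,P,Q)=\max\{c(Q,\mathcal{F}):\mathcal{F}\subseteq 2^{[n]},\ c(P,\mathcal{F})=0\}$. For families of posets $\mathcal{P},\mathcal{Q}$, $La(n,\mathcal{P},\mathcal{Q})=\max\{\sum_{Q\in\mathcal{Q}}c(Q,\mathcal{F}):\mathcal{F}\subseteq 2^{[n]},\ c(P,\mathcal{F})=0\text{ for all }P\in\mathcal{P}\}$; a single poset in either place stands for the one-element family containing it. Posets: $P_k$ is the chain on $k$ elements. $\bigvee_r$ has $r+1$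 elements $0,a_1,\dots,a_r$ with relations $0\le a_i$ for all $i$; $\bigwedge_r$ has $r+1$ elements $a_1,\dots,a_r,1$ with relations $a_i\le 1$ for all $i$; $\bigvee=\bigvee_2$ and $\bigwedge=\bigwedge_2$. The butterfly $B$ has four elements $a,b,c,d$ with $a,b\le c,d$ (all four relations). The generalized diamond $D_r$ has $r+2$ elements $a,b_1,\dots,b_r,c$ with $a<b_1,\dots,b_r<c$.
   Formalization: Part (c) is stated for all positive n, r except n = r = 1, where it fails: 2^[1] has only two members and D_1 has three elements, so La(1,B,D_1) = 0, while the formula gives 1. -}

module Defs where

open import Data.Bool.Properties using () renaming (_≟_ to _≟ᵇ_)
open import Data.Empty using (⊥-elim)
open import Data.Fin as Fin using (Fin; zero; suc; toℕ; fromℕ; finToFun; funToFin)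
import Data.Fin.Properties as Fin
open import Data.Fin.Subset using (Subset; inside; outside; _⊆_)
open import Data.Fin.Subset.Properties using (_⊆?_)
open import Data.List using (List; []; _∷_; _++_; map; filter; length; lookup)
open import Data.List.Extrema.Nat using (max)
open import Data.List.Membership.Propositional using (_∈_)
open import Data.List.Membership.Propositional.Properties using (∈-lookup)
import Data.List.Relation.Unary.All as All
import Data.List.Relation.Unary.Any as Any
open import Data.List.Relation.Unary.Any.Properties using (lookup-index)
open import Data.Nat as ℕ using (ℕ; zero; suc; _+_; _^_)
open import Data.Nat.ListAction using (sum)
import Data.Nat.Properties as ℕ
open import Data.Product using (∃; _×_; _,_)
open import Data.Sum using (_⊎_; inj₁; inj₂)
open import Data.Vec using ([]; _∷_)
open import Data.Vec.Properties using (≡-dec)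
open import Function using (_∘_)
open import Function.Definitions using (Injective)
open import Level using (0ℓ)
open import Relation.Binary using (Rel; DecidableEquality; IsDecPartialOrder; IsDecTotalOrder)
open import Relation.Binary.PropositionalEquality
  using (_≡_; _≗_; refl; sym; trans; cong; subst; subst₂; isEquivalence)
open import Relation.Nullary using (Dec)
open import Relation.Nullary.Decidable using (map′; _×-dec_; _⊎-dec_; _→-dec_)

------------------------------------------------------------------------
-- Finite posets

-- Decidability of the order is part of the structure so that copies can be
-- counted by a function.

record FinPoset : Set₁ where
  infix 4 _≤_
  field
    size              : ℕ
    _≤_               : Rel (Fin size) 0ℓ
    isDecPartialOrder : IsDecPartialOrder _≡_ _≤_

  open IsDecPartialOrder isDecPartialOrder public using (_≤?_)

------------------------------------------------------------------------
-- Families of sets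

-- A family of subsets of [n] is a duplicate-free list of subsets; [n] is
-- encoded as Fin n.  To have exactly one list for each family, families are
-- only ever taken from subfamilies (subsets n), and their subfamilies from
-- subfamilies of those.

Family : ℕ → Set
Family n = List (Subset n)

subsets : ∀ n → Family n
subsets zero    = [] ∷ []
subsets (suc n) = map (outside ∷_) (subsets n) ++ map (inside ∷_) (subsets n)

subfamilies : ∀ {n} → Family n → List (Family n)
subfamilies []      = [] ∷ []
subfamilies (X ∷ F) = subfamilies F ++ map (X ∷_) (subfamilies F)

------------------------------------------------------------------------
-- Copies of a poset

-- φ is an order-preserving bijection from P onto the members of 𝒢; it need
-- not reflect the order.

record IsCopyMap (P : FinPoset) {n} (𝒢 : Family n)
                 (φ : Fin (FinPoset.size P) → Subset n) : Set where
  open FinPoset P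
  field
    injective : Injective _≡_ _≡_ φ
    into      : ∀ x → φ x ∈ 𝒢
    onto      : ∀ {X} → X ∈ 𝒢 → ∃ λ x → φ x ≡ X
    monotone  : ∀ {x y} → x ≤ y → φ x ⊆ φ y

IsCopy : (P : FinPoset) → ∀ {n} → Family n → Set
IsCopy P 𝒢 = ∃ (IsCopyMap P 𝒢)

_≟ˢ_ : ∀ {n} → DecidableEquality (Subset n)
_≟ˢ_ = ≡-dec _≟ᵇ_

module _ (P : FinPoset) {n} (𝒢 : Family n) where
  open FinPoset P
  open import Data.List.Membership.DecPropositional (_≟ˢ_ {n}) using (_∈?_)

  isCopyMap? : ∀ φ → Dec (IsCopyMap P 𝒢 φ)
  isCopyMap? φ = map′
    (λ (i , m , o , h) → record
      { injective = λ {x} {y} → i x y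
      ; into      = m
      ; onto      = All.lookup o
      ; monotone  = λ {x} {y} → h x y })
    (λ c → let open IsCopyMap c in
      (λ x y → injective) , into , All.tabulate onto , (λ x y → monotone))
    ( (Fin.all? λ x → Fin.all? λ y → (φ x ≟ˢ φ y) →-dec (x Fin.≟ y))
    ×-dec (Fin.all? λ x → φ x ∈? 𝒢)
    ×-dec (All.all? (λ X → Fin.any? λ x → φ x ≟ˢ X) 𝒢)
    ×-dec (Fin.all? λ x → Fin.all? λ y → (x ≤? y) →-dec (φ x ⊆? φ y)))

  isCopyMap-resp-≗ : ∀ {φ ψ} → φ ≗ ψ → IsCopyMap P 𝒢 φ → IsCopyMap P 𝒢 ψ
  isCopyMap-resp-≗ {φ} {ψ} φ≗ψ c = record
    { injective = λ {x} {y} e → injective (trans (φ≗ψ x) (trans e (sym (φ≗ψ y))))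
    ; into      = λ x → subst (_∈ 𝒢) (φ≗ψ x) (into x)
    ; onto      = λ X∈𝒢 → let (x , e) = onto X∈𝒢 in x , trans (sym (φ≗ψ x)) e
    ; monotone  = λ {x} {y} x≤y → subst₂ _⊆_ (φ≗ψ x) (φ≗ψ y) (monotone x≤y)
    }
    where open IsCopyMap c

  isCopy? : Dec (IsCopy P 𝒢)
  isCopy? = map′
    (λ (k , c) → lookup 𝒢 ∘ finToFun k , c)
    (λ (φ , c) → let open IsCopyMap c
                     f = λ x → Any.index (into x) in
      funToFin f ,
      isCopyMap-resp-≗
        (λ x → trans (lookup-index (into x))
                     (cong (lookup 𝒢) (sym (Fin.finToFun-funToFin f x))))
        c)
    (Fin.any? {n = length 𝒢 ^ size} λ k → isCopyMap? (lookup 𝒢 ∘ finToFun k))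

copies : FinPoset → ∀ {n} → Family n → ℕ
copies P F = length (filter (isCopy? P) (subfamilies F))

------------------------------------------------------------------------
-- La(n, 𝒫, 𝒬)

freeFamilies : ∀ n → List FinPoset → List (Family n)
freeFamilies n 𝒫 =
  filter (λ F → All.all? (λ P → copies P F ℕ.≟ 0) 𝒫) (subfamilies (subsets n))

-- The default value 0 of max matters only if no family is 𝒫-free, which
-- cannot happen when the posets in 𝒫 are nonempty: the empty family is free.

La : ℕ → List FinPoset → List FinPoset → ℕ
La n 𝒫 𝒬 = max 0 (map (λ F → sum (map (λ Q → copies Q F) 𝒬)) (freeFamilies n 𝒫))

------------------------------------------------------------------------
-- The posets of the theorem

chain : ℕ → FinPoset
chain k = record
  { size              = k
  ; _≤_               = Fin._≤_
  ; isDecPartialOrder = IsDecTotalOrder.isDecPartialOrder Fin.≤-isDecTotalOrder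
  }

-- The element 0 is zero, and aᵢ is suc i.

⋁ : ℕ → FinPoset
⋁ r = record
  { size              = suc r
  ; _≤_               = _≤_
  ; isDecPartialOrder = record
    { isPartialOrder = record
      { isPreorder = record
        { isEquivalence = isEquivalence
        ; reflexive     = inj₁
        ; trans         = λ { (inj₁ refl) q → q
                            ; (inj₂ x≡0) _ → inj₂ x≡0 } }
      ; antisym = λ { (inj₁ x≡y) _ → x≡y
                    ; (inj₂ _) (inj₁ y≡x) → sym y≡x
                    ; (inj₂ x≡0) (inj₂ y≡0) → trans x≡0 (sym y≡0) } }
    ; _≟_  = Fin._≟_
    ; _≤?_ = λ x y → (x Fin.≟ y) ⊎-dec (x Fin.≟ zero) } }
  where
  _≤_ : Rel (Fin (suc r)) 0ℓ
  x ≤ y = x ≡ y ⊎ x ≡ zero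

-- The element 1 is the last index fromℕ r.

⋀ : ℕ → FinPoset
⋀ r = record
  { size              = suc r
  ; _≤_               = _≤_
  ; isDecPartialOrder = record
    { isPartialOrder = record
      { isPreorder = record
        { isEquivalence = isEquivalence
        ; reflexive     = inj₁
        ; trans         = λ { p (inj₁ refl) → p
                            ; _ (inj₂ z≡1) → inj₂ z≡1 } }
      ; antisym = λ { (inj₁ x≡y) _ → x≡y
                    ; (inj₂ _) (inj₁ y≡x) → sym y≡x
                    ; (inj₂ y≡1) (inj₂ x≡1) → trans x≡1 (sym y≡1) } }
    ; _≟_  = Fin._≟_
    ; _≤?_ = λ x y → (x Fin.≟ y) ⊎-dec (y Fin.≟ fromℕ r) } }
  where
  _≤_ : Rel (Fin (suc r)) 0ℓ
  x ≤ y = x ≡ y ⊎ y ≡ fromℕ r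

-- a, b, c, d are 0, 1, 2, 3.

butterfly : FinPoset
butterfly = record
  { size              = 4
  ; _≤_               = _≤_
  ; isDecPartialOrder = record
    { isPartialOrder = record
      { isPreorder = record
        { isEquivalence = isEquivalence
        ; reflexive     = inj₁
        ; trans         = λ { (inj₁ refl) q → q
                            ; p (inj₁ refl) → p
                            ; (inj₂ (_ , 2≤y)) (inj₂ (y<2 , _)) →
                                ⊥-elim (ℕ.<⇒≱ y<2 2≤y) } }
      ; antisym = λ { (inj₁ x≡y) _ → x≡y
                    ; (inj₂ _) (inj₁ y≡x) → sym y≡x
                    ; (inj₂ (_ , 2≤y)) (inj₂ (y<2 , _)) →
                        ⊥-elim (ℕ.<⇒≱ y<2 2≤y) } }
    ; _≟_  = Fin._≟_
    ; _≤?_ = λ x y →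
        (x Fin.≟ y) ⊎-dec ((toℕ x ℕ.<? 2) ×-dec (2 ℕ.≤? toℕ y)) } }
  where
  _≤_ : Rel (Fin 4) 0ℓ
  x ≤ y = x ≡ y ⊎ (toℕ x ℕ.< 2 × 2 ℕ.≤ toℕ y)

-- a is zero, c is the last index fromℕ (suc r), and b₁, …, b_r are the
-- indices 1, …, r.

diamond : ℕ → FinPoset
diamond r = record
  { size              = 2 + r
  ; _≤_               = _≤_
  ; isDecPartialOrder = record
    { isPartialOrder = record
      { isPreorder = record
        { isEquivalence = isEquivalence
        ; reflexive     = inj₁
        ; trans         = λ { (inj₁ refl) q → q
                            ; p (inj₁ refl) → p
                            ; (inj₂ (inj₁ x≡a)) _ → inj₂ (inj₁ x≡a)
                            ; (inj₂ (inj₂ _)) (inj₂ (inj₂ z≡c)) → inj₂ (inj₂ z≡c)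
                            ; (inj₂ (inj₂ refl)) (inj₂ (inj₁ ())) } }
      ; antisym = λ { (inj₁ x≡y) _ → x≡y
                    ; (inj₂ _) (inj₁ y≡x) → sym y≡x
                    ; (inj₂ (inj₁ x≡a)) (inj₂ (inj₁ y≡a)) → trans x≡a (sym y≡a)
                    ; (inj₂ (inj₁ refl)) (inj₂ (inj₂ ()))
                    ; (inj₂ (inj₂ refl)) (inj₂ (inj₁ ()))
                    ; (inj₂ (inj₂ y≡c)) (inj₂ (inj₂ x≡c)) → trans x≡c (sym y≡c) } }
    ; _≟_  = Fin._≟_
    ; _≤?_ = λ x y →
        (x Fin.≟ y) ⊎-dec ((x Fin.≟ zero) ⊎-dec (y Fin.≟ fromℕ (suc r))) } }
  where
  _≤_ : Rel (Fin (2 + r)) 0ℓ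
  x ≤ y = x ≡ y ⊎ x ≡ zero ⊎ y ≡ fromℕ (suc r)

{-# OPTIONS --safe #-}

-- A copy of ⋀ᵣ in a ⋁-free family, of ⋁ᵣ in a ⋀-free family, or of Dᵣ in a
-- butterfly-free family is determined by its r members other than the apex
-- (other than a and c in Dᵣ), because the member above, resp. below, any of
-- those is unique.  These r-sets all lie in one antichain, so Sperner's theorem
-- bounds the number of copies by the number of r-subsets of a middle layer; the
-- middle layer with ∅ and/or [n] added attains the bound.  P₂ is ⋀₁ and ⋁₁.
--
-- In a {⋁, ⋀}-free family the copies A ⊊ B of P₂ satisfy A ⊈ B′ for distinct
-- copies, so A and the complement of B form a cross-intersecting system of
-- disjoint pairs on at most n − 1 points, and Bollobás' set-pair inequality gives
-- the bound.  Sperner's theorem is the case A = B of the same inequality.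

module Submission where

open import Defs
open import Data.Fin.Base as Fin using (Fin; zero; suc; fromℕ; inject₁)
import Data.Fin.Properties as Fin
open import Data.Fin.Relation.Unary.Top
  using (View; ‵fromℕ; ‵inj₁; view; view-fromℕ; view-inject₁)
open import Data.Fin.Subset using (Subset; inside; outside; _⊆_; ∣_∣; ⊤; ⊥)
  renaming (_∈_ to _∈ˢ_; _∉_ to _∉ˢ_)
import Data.Fin.Subset.Properties as Subset
open import Data.List using ([]; _∷_; [_])
open import Data.List.Base
  using (List; map; filter; length; lookup; tabulate; cartesianProduct)
open import Data.List.Extrema.Nat using (max; max≤v⁺; v≤max⁺)
open import Data.List.Membership.Propositional using (_∈_; find)
open import Data.List.Membership.Propositional.Properties
  using ( ∈-lookup; ∈-filter⁺; ∈-filter⁻; ∈-map⁺; ∈-map⁻; ∈-++⁺ˡ; ∈-++⁺ʳ; ∈-++⁻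
        ; ∈-tabulate⁺; ∈-tabulate⁻; ∈-cartesianProduct⁺; ∈-cartesianProduct⁻ )
import Data.List.Properties as List
open import Data.List.Relation.Binary.Sublist.Propositional
  using ([]; _∷_; _∷ʳ_; ⊆-refl) renaming (_⊆_ to _⊑_)
import Data.List.Relation.Binary.Sublist.Propositional as Sublist
import Data.List.Relation.Binary.Sublist.Propositional.Properties as Sublist
open import Data.List.Relation.Unary.All as All using (All; []; _∷_)
import Data.List.Relation.Unary.All.Properties as All
open import Data.List.Relation.Unary.AllPairs using (AllPairs; []; _∷_)
import Data.List.Relation.Unary.AllPairs.Properties as AllPairs
open import Data.List.Relation.Unary.Any as Any using (Any; here; there)
open import Data.List.Relation.Unary.Any.Properties using (lookup-index)
open import Data.List.Relation.Unary.Unique.Propositional using (Unique)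
import Data.List.Relation.Unary.Unique.Propositional.Properties as Unique
open import Data.Nat using (ℕ; _≤_; _∸_; ⌊_/2⌋)
open import Data.Nat.Base
  using ( zero; suc; pred; _+_; _*_; _<_; _≤′_; ≤′-refl; ≤′-step; NonZero
        ; z≤n; s≤s; _!; ⌈_/2⌉ )
open import Data.Nat.Combinatorics using (_C_)
open import Data.Nat.Combinatorics
  using ( nC1≡n; nCk≡n!/k![n-k]!; k![n∸k]!∣n!; nCk≡nC[n∸k]; nCk+nC[k+1]≡[n+1]C[k+1]
        ; k>n⇒nCk≡0 )
open import Data.Nat.DivMod using (m/n*n≡m)
open import Data.Nat.ListAction using (sum)
import Data.Nat.Properties as ℕ
open import Data.Nat.Tactic.RingSolver using (solve-∀)
open import Data.Product using (_×_)
open import Data.Product using (∃; _,_; proj₁; proj₂)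
open import Data.Sum using (_⊎_; inj₁; inj₂)
open import Data.Vec.Base as Vec using (Vec; []; _∷_; here; there)
import Data.Vec.Functional as Vector
import Data.Vec.Properties as Vec
open import Function.Base using (_∘_; id)
open import Function.Definitions using (Injective)
open import Level using (0ℓ)
open import Relation.Binary.PropositionalEquality using (_≡_)
open import Relation.Binary.PropositionalEquality
  using (_≢_; refl; sym; trans; cong; cong₂; subst; module ≡-Reasoning)
open import Relation.Nullary using (¬_)
open import Relation.Nullary using (Dec; yes; no; contradiction)
open import Relation.Nullary.Decidable
  using (decidable-stable; ¬?; _×-dec_; _⊎-dec_; _→-dec_)
open import Relation.Unary using (Pred; Decidable)
open import Algebra.Properties.CommutativeMonoid.Sum ℕ.+-0-commutativeMonoid
  using (∑-distrib-+; sum-cong-≗; sum-replicate-zero) renaming (sum to ∑)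

-- A copy is a bare subfamily: it does not record which member plays which role, and several maps
-- may realise it. The roles are therefore read off by a property of sets that is fixed in advance.
-- In the upper bounds a set plays a non-apex role when F has a member above it (below it for ⋁ᵣ, on
-- both sides for Dᵣ); in the constructions, when it lies in the chosen layer.
--
-- Copies need not reflect the order, so a chain of three sets already contains ⋁ and ⋀, and a chain
-- of four contains a butterfly. This is what makes the sets with a non-apex role an antichain: two
-- comparable ones, together with the members of F beyond them, would form such a chain.
--
-- Bollobás' inequality says that the sum of 1 / C(a + c, a) over the pairs, a and c being the sizes
-- of the two sets, is at most 1. Multiplied by n ! it becomes a statement about natural numbers:
-- the summand of a pair is then the number of orderings of the n points in which the first set
-- precedes the second.

-- Binomial coefficients

C-! : ∀ {n k} → k ≤ n → (n C k) * (k ! * (n ∸ k) !) ≡ n !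
C-! {n} {k} k≤n = trans (cong (_* (k ! * (n ∸ k) !)) (nCk≡n!/k![n-k]! k≤n))
                        (m/n*n≡m {{ℕ.m*n≢0 _ _ {{k ℕ.!≢0}} {{(n ∸ k) ℕ.!≢0}}}} (k![n∸k]!∣n! k≤n))

C-!′ : ∀ a c → ((a + c) C a) * (a ! * c !) ≡ (a + c) !
C-!′ a c = trans (cong (λ d → ((a + c) C a) * (a ! * d !)) (sym (ℕ.m+n∸m≡n a c))) (C-! (ℕ.m≤m+n a c))

C-stepˡ : ∀ n k → n C k ≤ suc n C k
C-stepˡ n zero    = ℕ.≤-refl
C-stepˡ n (suc k) = ℕ.≤-trans (ℕ.m≤n+m _ _) (ℕ.≤-reflexive (nCk+nC[k+1]≡[n+1]C[k+1] n k))

C-monoˡ : ∀ {m n} k → m ≤ n → m C k ≤ n C k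
C-monoˡ {m} k m≤n = go (ℕ.≤⇒≤′ m≤n)
  where
  go : ∀ {n} → m ≤′ n → m C k ≤ n C k
  go ≤′-refl     = ℕ.≤-refl
  go (≤′-step p) = ℕ.≤-trans (go p) (C-stepˡ _ k)

-- Both coefficients, times their own two factorials, give `(a + suc c) !`, so their ratio is suc c
-- : suc a. Cancelling `a ! * suc c !` avoids division.
C-stepʳ′ : ∀ a c → a ≤ c → (a + suc c) C a ≤ (a + suc c) C suc a
C-stepʳ′ a c a≤c = ℕ.*-cancelʳ-≤ _ _ (a ! * suc c !) {{a!*[1+c]!≢0}} (begin
  ((a + suc c) C a) * (a ! * suc c !)        ≡⟨ C-!′ a (suc c) ⟩
  (a + suc c) !                              ≡⟨ cong _! (ℕ.+-suc a c) ⟩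
  (suc a + c) !                              ≡⟨ C-!′ (suc a) c ⟨
  ((suc a + c) C suc a) * (suc a ! * c !)    ≡⟨ cong (λ n → (n C suc a) * (suc a ! * c !)) (ℕ.+-suc a c) ⟨
  N * (suc a * a ! * c !)                    ≤⟨ ℕ.*-monoʳ-≤ N (ℕ.*-monoˡ-≤ (c !) (ℕ.*-monoˡ-≤ (a !) (s≤s a≤c))) ⟩
  N * (suc c * a ! * c !)                    ≡⟨ cong (N *_) (lemma (suc c) (a !) (c !)) ⟩
  N * (a ! * suc c !)                        ∎)
  where
  open ℕ.≤-Reasoning
  N = (a + suc c) C suc a
  a!*[1+c]!≢0 : NonZero (a ! * suc c !)
  a!*[1+c]!≢0 = ℕ.m*n≢0 _ _ {{a ℕ.!≢0}} {{suc c ℕ.!≢0}}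
  lemma : ∀ x y z → x * y * z ≡ y * (x * z)
  lemma = solve-∀

C-stepʳ : ∀ {n k} → suc (k + k) ≤ n → n C k ≤ n C suc k
C-stepʳ {n} {k} 2k<n = subst (λ m → m C k ≤ m C suc k) eq
  (C-stepʳ′ k (n ∸ suc k) (ℕ.m+n≤o⇒m≤o∸n k (subst (_≤ n) (sym (ℕ.+-suc k k)) 2k<n)))
  where
  eq : k + suc (n ∸ suc k) ≡ n
  eq = trans (ℕ.+-suc k _) (ℕ.m+[n∸m]≡n (ℕ.≤-trans (s≤s (ℕ.m≤m+n k k)) 2k<n))

C-monoʳ : ∀ {n k h} → k ≤ h → h + h ≤ n → n C k ≤ n C h
C-monoʳ {n} {k} {h} k≤h 2h≤n with ℕ.m≤n⇒m<n∨m≡n k≤h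
... | inj₂ refl = ℕ.≤-refl
C-monoʳ {n} {k} {suc h} _ 2h≤n | inj₁ (s≤s k≤h) =
  ℕ.≤-trans (C-monoʳ k≤h (ℕ.<⇒≤ 2h<n)) (C-stepʳ 2h<n)
  where
  2h<n : suc (h + h) ≤ n
  2h<n = ℕ.≤-trans (s≤s (ℕ.+-monoʳ-≤ h (ℕ.n≤1+n h))) 2h≤n

2⌊n/2⌋≤n : ∀ n → ⌊ n /2⌋ + ⌊ n /2⌋ ≤ n
2⌊n/2⌋≤n n = subst (⌊ n /2⌋ + ⌊ n /2⌋ ≤_) (ℕ.⌊n/2⌋+⌈n/2⌉≡n n) (ℕ.+-monoʳ-≤ ⌊ n /2⌋ (ℕ.⌊n/2⌋≤⌈n/2⌉ n))

C-central : ∀ n k → n C k ≤ n C ⌊ n /2⌋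
C-central n k with k ℕ.≤? ⌊ n /2⌋ | k ℕ.≤? n
... | yes k≤h | _       = C-monoʳ k≤h (2⌊n/2⌋≤n n)
... | no _    | no k≰n  = subst (_≤ n C ⌊ n /2⌋) (sym (k>n⇒nCk≡0 (ℕ.≰⇒> k≰n))) z≤n
-- Past the middle, symmetry reflects k to n ∸ k, which is at most the middle.
... | no k≰h  | yes k≤n = subst (_≤ n C ⌊ n /2⌋) (sym (nCk≡nC[n∸k] k≤n)) (C-monoʳ n∸k≤h (2⌊n/2⌋≤n n))
  where
  open ℕ.≤-Reasoning
  n≤k+h : n ≤ k + ⌊ n /2⌋
  n≤k+h = begin
    n                      ≡⟨ ℕ.⌊n/2⌋+⌈n/2⌉≡n n ⟨
    ⌊ n /2⌋ + ⌈ n /2⌉      ≤⟨ ℕ.+-monoʳ-≤ ⌊ n /2⌋ (ℕ.⌊n/2⌋-mono (ℕ.n≤1+n (suc n))) ⟩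
    ⌊ n /2⌋ + suc ⌊ n /2⌋  ≤⟨ ℕ.+-monoʳ-≤ ⌊ n /2⌋ (ℕ.≰⇒> k≰h) ⟩
    ⌊ n /2⌋ + k            ≡⟨ ℕ.+-comm ⌊ n /2⌋ k ⟩
    k + ⌊ n /2⌋            ∎
  n∸k≤h : n ∸ k ≤ ⌊ n /2⌋
  n∸k≤h = ℕ.m≤n+o⇒m∸n≤o n k n≤k+h

C-≤-central : ∀ {j m} k → j ≤ m → j C k ≤ m C ⌊ m /2⌋
C-≤-central {j} {m} k j≤m = ℕ.≤-trans (C-monoˡ k j≤m) (C-central m k)

-- Bollobás' set-pair inequality

-- A word stands for a pair A ⊆ B: 𝟙 marks A, 𝟘 the complement of B, ✶ the rest.
data Letter : Set where
  𝟙 𝟘 ✶ : Letter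

Word : ℕ → Set
Word = Vec Letter

δ : Letter → Letter → ℕ
δ 𝟙 𝟙 = 1
δ 𝟘 𝟘 = 1
δ ✶ ✶ = 1
δ _ _ = 0

count : ∀ {n} → Letter → Word n → ℕ
count l []      = 0
count l (x ∷ v) = δ l x + count l v

count-removeAt : ∀ {n} l (v : Word (suc n)) x →
  count l v ≡ δ l (Vec.lookup v x) + count l (Vec.removeAt v x)
count-removeAt l (y ∷ v)           zero    = refl
count-removeAt l (y ∷ v@(_ ∷ _)) (suc x) =
  trans (cong (δ l y +_) (count-removeAt l v x)) (swap (δ l y) (δ l (Vec.lookup v x)) _)
  where
  swap : ∀ a b c → a + (b + c) ≡ b + (a + c)
  swap = solve-∀

count-total : ∀ {n} (v : Word n) → count 𝟙 v + count 𝟘 v + count ✶ v ≡ n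
count-total []      = refl
count-total (𝟙 ∷ v) = cong suc (count-total v)
count-total (𝟘 ∷ v) = trans (cong (_+ count ✶ v) (ℕ.+-suc (count 𝟙 v) _)) (cong suc (count-total v))
count-total (✶ ∷ v) = trans (ℕ.+-suc _ _) (cong suc (count-total v))

lookup⇒0<count : ∀ {n} l (v : Word n) x → Vec.lookup v x ≡ l → 0 < count l v
lookup⇒0<count 𝟙 (_ ∷ v) zero refl = s≤s z≤n
lookup⇒0<count 𝟘 (_ ∷ v) zero refl = s≤s z≤n
lookup⇒0<count ✶ (_ ∷ v) zero refl = s≤s z≤n
lookup⇒0<count l (y ∷ v) (suc x) e = ℕ.≤-trans (lookup⇒0<count l v x e) (ℕ.m≤n+m _ (δ l y))

∑-by-letter : ∀ {n} (h : Letter → ℕ) (v : Word n) →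
  ∑ (h ∘ Vec.lookup v) ≡ count 𝟙 v * h 𝟙 + count 𝟘 v * h 𝟘 + count ✶ v * h ✶
∑-by-letter h []      = refl
∑-by-letter h (x ∷ v) = trans (cong (h x +_) (∑-by-letter h v)) (step x)
  where
  lem₁ : ∀ x y z a b c → x + (a * x + b * y + c * z) ≡ (1 + a) * x + b * y + c * z
  lem₁ = solve-∀
  lem₂ : ∀ x y z a b c → y + (a * x + b * y + c * z) ≡ a * x + (1 + b) * y + c * z
  lem₂ = solve-∀
  lem₃ : ∀ x y z a b c → z + (a * x + b * y + c * z) ≡ a * x + b * y + (1 + c) * z
  lem₃ = solve-∀
  step : ∀ x → h x + (count 𝟙 v * h 𝟙 + count 𝟘 v * h 𝟘 + count ✶ v * h ✶)
             ≡ count 𝟙 (x ∷ v) * h 𝟙 + count 𝟘 (x ∷ v) * h 𝟘 + count ✶ (x ∷ v) * h ✶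
  step 𝟙 = lem₁ (h 𝟙) (h 𝟘) (h ✶) (count 𝟙 v) (count 𝟘 v) (count ✶ v)
  step 𝟘 = lem₂ (h 𝟙) (h 𝟘) (h ✶) (count 𝟙 v) (count 𝟘 v) (count ✶ v)
  step ✶ = lem₃ (h 𝟙) (h 𝟘) (h ✶) (count 𝟙 v) (count 𝟘 v) (count ✶ v)

-- The number of orderings of a + c + k points in which a given points all
-- come before c other given points.
orderings : ℕ → ℕ → ℕ → ℕ
orderings a c zero    = a ! * c !
orderings a c (suc k) = (a + c + suc k) * orderings a c k

C-orderings : ∀ a c k → ((a + c) C a) * orderings a c k ≡ (a + c + k) !
C-orderings a c zero    = trans (C-!′ a c) (cong _! (sym (ℕ.+-identityʳ (a + c))))
C-orderings a c (suc k) = begin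
  ((a + c) C a) * ((a + c + suc k) * orderings a c k)  ≡⟨ swap ((a + c) C a) (a + c + suc k) _ ⟩
  (a + c + suc k) * (((a + c) C a) * orderings a c k)  ≡⟨ cong ((a + c + suc k) *_) (C-orderings a c k) ⟩
  (a + c + suc k) * (a + c + k) !                    ≡⟨ cong (_* (a + c + k) !) (ℕ.+-suc (a + c) k) ⟩
  suc (a + c + k) * (a + c + k) !                    ≡⟨ cong _! (ℕ.+-suc (a + c) k) ⟨
  (a + c + suc k) !                                  ∎
  where
  open ≡-Reasoning
  swap : ∀ x y z → x * (y * z) ≡ y * (x * z)
  swap = solve-∀

-- Sort the orderings by their last point. It is one of the `suc c` late points or one of the k free
-- points, never an early one, because some late point exists. For k ≡ 0 the last term vanishes
-- whatever `pred` returns.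
orderings-rec : ∀ a c k →
  orderings a (suc c) k ≡ suc c * orderings a c k + k * orderings a (suc c) (pred k)
orderings-rec a c zero          = lemma (a !) (suc c) (c !)
  where
  lemma : ∀ x y z → x * (y * z) ≡ y * (x * z) + 0
  lemma = solve-∀
orderings-rec a c (suc zero)    = lemma a c (a !) (c !)
  where
  lemma : ∀ a c x y → (a + (1 + c) + 1) * (x * ((1 + c) * y))
        ≡ (1 + c) * ((a + c + 1) * (x * y)) + 1 * (x * ((1 + c) * y))
  lemma = solve-∀
orderings-rec a c (suc (suc k)) = begin
  (s + suc (suc k)) * V
    ≡⟨ split a c k V ⟩
  (s + suc k) * V + V
    ≡⟨ cong (λ w → (s + suc k) * w + V) (orderings-rec a c (suc k)) ⟩
  (s + suc k) * (suc c * W + suc k * U) + V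
    ≡⟨ lemma a c k W U ⟩
  suc c * ((a + c + suc (suc k)) * W) + (suc k * V + V)
    ≡⟨ cong (suc c * ((a + c + suc (suc k)) * W) +_) (ℕ.+-comm (suc k * V) V) ⟩
  suc c * ((a + c + suc (suc k)) * W) + suc (suc k) * V ∎
  where
  open ≡-Reasoning
  s = a + suc c
  V = orderings a (suc c) (suc k)
  U = orderings a (suc c) k
  W = orderings a c (suc k)
  split : ∀ a c k v → (a + (1 + c) + (2 + k)) * v ≡ (a + (1 + c) + (1 + k)) * v + v
  split = solve-∀
  lemma : ∀ a c k w u →
    (a + (1 + c) + (1 + k)) * ((1 + c) * w + (1 + k) * u) + (a + (1 + c) + (1 + k)) * u
    ≡ (1 + c) * ((a + c + (2 + k)) * w)
      + ((1 + k) * ((a + (1 + c) + (1 + k)) * u) + (a + (1 + c) + (1 + k)) * u)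
  lemma = solve-∀

-- Bollobás' summand 1 / C(a + c, a), scaled by n !.
weight : ∀ {n} → Word n → ℕ
weight v = orderings (count 𝟙 v) (count 𝟘 v) (count ✶ v)

C-weight : ∀ {n} (v : Word n) → ((count 𝟙 v + count 𝟘 v) C count 𝟙 v) * weight v ≡ n !
C-weight v = trans (C-orderings (count 𝟙 v) (count 𝟘 v) (count ✶ v)) (cong _! (count-total v))

-- Provided v has a 𝟘, this is the number of orderings counted by `weight v` that end in x: a 𝟙
-- cannot come last then.
share : ∀ {n} → Word (suc n) → Fin (suc n) → ℕ
share v x with Vec.lookup v x
... | 𝟙 = 0
... | 𝟘 = weight (Vec.removeAt v x)
... | ✶ = weight (Vec.removeAt v x)

weight-split : ∀ {n} (v : Word (suc n)) → 0 < count 𝟘 v → weight v ≡ ∑ (share v)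
weight-split v 0<c = begin
  orderings a c k                                       ≡⟨ rec c 0<c ⟩
  c * orderings a (pred c) k + k * orderings a c (pred k)  ≡⟨ cong (λ z → z + c * h 𝟘 + k * h ✶) (ℕ.*-zeroʳ a) ⟨
  a * h 𝟙 + c * h 𝟘 + k * h ✶                           ≡⟨ ∑-by-letter h v ⟨
  ∑ (h ∘ Vec.lookup v)                                  ≡⟨ sum-cong-≗ share-h ⟨
  ∑ (share v)                                           ∎
  where
  open ≡-Reasoning
  a = count 𝟙 v
  c = count 𝟘 v
  k = count ✶ v
  rec : ∀ c → 0 < c → orderings a c k ≡ c * orderings a (pred c) k + k * orderings a c (pred k)
  rec (suc c) _ = orderings-rec a c k
  h : Letter → ℕ
  h 𝟙 = 0
  h 𝟘 = orderings a (pred c) k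
  h ✶ = orderings a c (pred k)
  share-h : ∀ x → share v x ≡ h (Vec.lookup v x)
  share-h x with Vec.lookup v x | count-removeAt 𝟙 v x | count-removeAt 𝟘 v x | count-removeAt ✶ v x
  ... | 𝟙 | _  | _  | _  = refl
  ... | 𝟘 | e₁ | e₀ | e✶ rewrite e₁ | e₀ | e✶ = refl
  ... | ✶ | e₁ | e₀ | e✶ rewrite e₁ | e₀ | e✶ = refl

-- What remains of a system once x is declared the last point. A word with 𝟙 at x and a 𝟘 elsewhere
-- admits no such ordering and drops out; the others lose x.
delete : ∀ {n} → Fin (suc n) → List (Word (suc n)) → List (Word n)
delete x []       = []
delete x (v ∷ vs) with Vec.lookup v x
... | 𝟙 = delete x vs
... | 𝟘 = Vec.removeAt v x ∷ delete x vs
... | ✶ = Vec.removeAt v x ∷ delete x vs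

total : ∀ {n} → List (Word n) → ℕ
total = sum ∘ map weight

total-split : ∀ {n} {vs : List (Word (suc n))} → All (λ v → 0 < count 𝟘 v) vs →
  total vs ≡ ∑ (λ x → total (delete x vs))
total-split {n} []                      = sym (sum-replicate-zero (suc n))
total-split {vs = v ∷ vs} (0<c ∷ 0<cs) = begin
  weight v + total vs                                    ≡⟨ cong₂ _+_ (weight-split v 0<c) (total-split 0<cs) ⟩
  ∑ (share v) + ∑ (λ x → total (delete x vs))            ≡⟨ ∑-distrib-+ (share v) (λ x → total (delete x vs)) ⟨
  ∑ (λ x → share v x + total (delete x vs))              ≡⟨ sum-cong-≗ step ⟩
  ∑ (λ x → total (delete x (v ∷ vs)))                    ∎
  where
  open ≡-Reasoning
  step : ∀ x → share v x + total (delete x vs) ≡ total (delete x (v ∷ vs))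
  step x with Vec.lookup v x
  ... | 𝟙 = refl
  ... | 𝟘 = refl
  ... | ✶ = refl

_↛_ : ∀ {n} → Word n → Word n → Set
v ↛ w = ∃ λ x → Vec.lookup v x ≡ 𝟙 × Vec.lookup w x ≡ 𝟘

Crossing : ∀ {n} → Word n → Word n → Set
Crossing v w = v ↛ w × w ↛ v

-- The witness carries 𝟙 in v, so it is not x and survives the deletion. Hence only 𝟙 at x has to be
-- excluded, not 𝟘.
↛-removeAt : ∀ {n} {v w : Word (suc n)} x → Vec.lookup v x ≢ 𝟙 →
  v ↛ w → Vec.removeAt v x ↛ Vec.removeAt w x
↛-removeAt {v = v} {w} x v[x]≢𝟙 (y , v[y]≡𝟙 , w[y]≡𝟘) =
  Fin.punchOut x≢y , trans (Vec.removeAt-punchOut v x≢y) v[y]≡𝟙 , trans (Vec.removeAt-punchOut w x≢y) w[y]≡𝟘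
  where
  x≢y : x ≢ y
  x≢y refl = v[x]≢𝟙 v[y]≡𝟙

Crossing-removeAt : ∀ {n} {v w : Word (suc n)} x → Vec.lookup v x ≢ 𝟙 → Vec.lookup w x ≢ 𝟙 →
  Crossing v w → Crossing (Vec.removeAt v x) (Vec.removeAt w x)
Crossing-removeAt {v = v} {w} x v[x]≢𝟙 w[x]≢𝟙 (v↛w , w↛v) =
  ↛-removeAt {v = v} {w} x v[x]≢𝟙 v↛w , ↛-removeAt {v = w} {v} x w[x]≢𝟙 w↛v

delete-Crossing : ∀ {n} x (v : Word (suc n)) {vs} → Vec.lookup v x ≢ 𝟙 →
  All (Crossing v) vs → All (Crossing (Vec.removeAt v x)) (delete x vs)
delete-Crossing x v v[x]≢𝟙 [] = []
delete-Crossing x v {w ∷ vs} v[x]≢𝟙 (c ∷ cs) with Vec.lookup w x in eq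
... | 𝟙 = delete-Crossing x v v[x]≢𝟙 cs
... | 𝟘 = Crossing-removeAt {v = v} {w} x v[x]≢𝟙 (λ e → contradiction (trans (sym eq) e) λ ()) c
        ∷ delete-Crossing x v v[x]≢𝟙 cs
... | ✶ = Crossing-removeAt {v = v} {w} x v[x]≢𝟙 (λ e → contradiction (trans (sym eq) e) λ ()) c
        ∷ delete-Crossing x v v[x]≢𝟙 cs

delete-AllPairs : ∀ {n} x {vs : List (Word (suc n))} →
  AllPairs Crossing vs → AllPairs Crossing (delete x vs)
delete-AllPairs x [] = []
delete-AllPairs x {v ∷ vs} (c ∷ cs) with Vec.lookup v x in eq
... | 𝟙 = delete-AllPairs x cs
... | 𝟘 = delete-Crossing x v (λ e → contradiction (trans (sym eq) e) λ ()) c ∷ delete-AllPairs x cs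
... | ✶ = delete-Crossing x v (λ e → contradiction (trans (sym eq) e) λ ()) c ∷ delete-AllPairs x cs

∑-≤ : ∀ {n M} (t : Fin n → ℕ) → (∀ x → t x ≤ M) → ∑ t ≤ n * M
∑-≤ {zero}  t t≤M = z≤n
∑-≤ {suc n} t t≤M = ℕ.+-mono-≤ (t≤M zero) (∑-≤ (t ∘ suc) (t≤M ∘ suc))

weight≤n! : ∀ {n} (v : Word n) → weight v ≤ n !
weight≤n! {n} v = ℕ.≤-trans
  (ℕ.m≤n*m (weight v) c {{ℕ.m*n≢0⇒m≢0 c {{subst NonZero (sym (C-weight v)) (n ℕ.!≢0)}}}})
  (ℕ.≤-reflexive (C-weight v))
  where
  c = (count 𝟙 v + count 𝟘 v) C count 𝟙 v

-- Bollobás' inequality, by averaging over the last point of an ordering.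
total≤n! : ∀ {n} {vs : List (Word n)} → AllPairs Crossing vs → total vs ≤ n !
total≤n! {vs = []}     _ = z≤n
-- A lone word may lack a 𝟘, and then it cannot be split by the last point; but a single weight is a
-- divisor of n !.
total≤n! {vs = v ∷ []} _ = subst (_≤ _) (sym (ℕ.+-identityʳ (weight v))) (weight≤n! v)
total≤n! {zero} {v ∷ w ∷ vs} ((((() , _) , _) ∷ _) ∷ _)
total≤n! {suc n} {vs@(v ∷ w ∷ ws)} cs@(vs-v@(((_ , (y , _ , v[y]≡𝟘)) ∷ _)) ∷ _) =
  subst (_≤ suc n !) (sym (total-split 0<cs))
    (∑-≤ {M = n !} (λ x → total (delete x vs)) λ x → total≤n! (delete-AllPairs x cs))
  where
  -- Crossing with v puts a 𝟘 into every other word, and crossing with w puts one into v.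
  0<cs : All (λ v → 0 < count 𝟘 v) vs
  0<cs = lookup⇒0<count 𝟘 v y v[y]≡𝟘
       ∷ All.map (λ {w} ((x , _ , w[x]≡𝟘) , _) → lookup⇒0<count 𝟘 w x w[x]≡𝟘) vs-v

-- Every word has n ! ≡ C(a + c, a) * weight ≤ N * weight, where N is the central coefficient.
-- Summing gives length * n ! ≤ N * total ≤ N * n !.
length-≤-C : ∀ {n m} {vs : List (Word n)} → All (λ v → count 𝟙 v + count 𝟘 v ≤ m) vs →
  AllPairs Crossing vs → length vs ≤ m C ⌊ m /2⌋
length-≤-C {n} {m} {vs} small cs =
  ℕ.*-cancelʳ-≤ _ _ (n !) {{n ℕ.!≢0}} (ℕ.≤-trans (go small) (ℕ.*-monoʳ-≤ N (total≤n! cs)))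
  where
  N = m C ⌊ m /2⌋
  go : ∀ {vs} → All (λ v → count 𝟙 v + count 𝟘 v ≤ m) vs → length vs * n ! ≤ N * total vs
  go []                  = z≤n
  go {v ∷ vs} (s ∷ ss) = ℕ.≤-trans
    (ℕ.+-mono-≤
      (ℕ.≤-trans (ℕ.≤-reflexive (sym (C-weight v))) (ℕ.*-monoˡ-≤ (weight v) (C-≤-central (count 𝟙 v) s)))
      (go ss))
    (ℕ.≤-reflexive (sym (ℕ.*-distribˡ-+ N (weight v) (total vs))))

-- Antichains and set pairs

lookup-injective : ∀ {A : Set} {xs : List A} → Unique xs → Injective _≡_ _≡_ (lookup xs)
lookup-injective (_   ∷ _)  {zero}  {zero}  _ = refl
lookup-injective (x∉ ∷ _)   {zero}  {suc j} e = contradiction e (All.lookup x∉ (∈-lookup j))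
lookup-injective (x∉ ∷ _)   {suc i} {zero}  e = contradiction (sym e) (All.lookup x∉ (∈-lookup i))
lookup-injective (_   ∷ xs!) {suc i} {suc j} e = cong suc (lookup-injective xs! e)

-- Pigeonhole for a relation in place of an injection: any related partner in ys will do, as R
-- determines its left argument.
length-≤ : ∀ {A B : Set} (R : A → B → Set) {xs ys} → Unique xs →
  (∀ {x} → x ∈ xs → ∃ λ y → y ∈ ys × R x y) →
  (∀ {x x′ y} → x ∈ xs → x′ ∈ xs → R x y → R x′ y → x ≡ x′) →
  length xs ≤ length ys
length-≤ {B = B} R {xs} {ys} xs! image inj =
  Fin.injective⇒≤ {f = Any.index ∘ ∈ys} λ {i} {j} e →
    lookup-injective xs! (inj (∈-lookup i) (∈-lookup j) (related i)
      (subst (R (lookup xs j)) (sym (same i j e)) (related j)))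
  where
  im : Fin (length xs) → B
  im i = proj₁ (image (∈-lookup i))
  ∈ys : ∀ i → im i ∈ ys
  ∈ys i = proj₁ (proj₂ (image (∈-lookup i)))
  related : ∀ i → R (lookup xs i) (im i)
  related i = proj₂ (proj₂ (image (∈-lookup i)))
  same : ∀ i j → Any.index (∈ys i) ≡ Any.index (∈ys j) → im i ≡ im j
  same i j e = trans (lookup-index (∈ys i)) (trans (cong (lookup ys) e) (sym (lookup-index (∈ys j))))

Unique⇒AllPairs : ∀ {A : Set} {R : A → A → Set} {xs} → Unique xs →
  (∀ {x y} → x ∈ xs → y ∈ xs → x ≢ y → R x y) → AllPairs R xs
Unique⇒AllPairs []         r = []
Unique⇒AllPairs (x∉ ∷ xs!) r =
  All.tabulate (λ y∈xs → r (here refl) (there y∈xs) (All.lookup x∉ y∈xs)) ∷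
  Unique⇒AllPairs xs! (λ x∈ y∈ → r (there x∈) (there y∈))

interval : ∀ {n} → Subset n → Subset n → Word n
interval = Vec.zipWith λ { inside _ → 𝟙 ; outside inside → ✶ ; outside outside → 𝟘 }

⊈⇒∃ : ∀ {n} {A B : Subset n} → ¬ A ⊆ B → ∃ λ x → x ∈ˢ A × x ∉ˢ B
⊈⇒∃ {n} {A} {B} A⊈B with Fin.¬∀⟶∃¬ n _ (λ x → (x Subset.∈? A) →-dec (x Subset.∈? B)) (λ f → A⊈B (f _))
... | x , ¬f with x Subset.∈? A
...   | yes x∈A = x , x∈A , λ x∈B → ¬f λ _ → x∈B
...   | no  x∉A = contradiction (λ x∈A → contradiction x∈A x∉A) ¬f

interval-𝟙 : ∀ {n} {A B : Subset n} {x} → x ∈ˢ A → Vec.lookup (interval A B) x ≡ 𝟙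
interval-𝟙 {A = inside ∷ A} {_ ∷ B} here = refl
interval-𝟙 {A = _ ∷ A} {_ ∷ B} (there x∈A) = interval-𝟙 {A = A} {B} x∈A

interval-𝟘 : ∀ {n} {A B : Subset n} {x} → x ∉ˢ A → x ∉ˢ B → Vec.lookup (interval A B) x ≡ 𝟘
interval-𝟘 {A = outside ∷ A} {outside ∷ B} {zero} _ _ = refl
interval-𝟘 {A = outside ∷ A} {inside ∷ B} {zero} _ x∉B = contradiction here x∉B
interval-𝟘 {A = inside ∷ A} {_ ∷ B} {zero} x∉A _ = contradiction here x∉A
interval-𝟘 {A = _ ∷ A} {_ ∷ B} {suc x} x∉A x∉B = interval-𝟘 {A = A} {B} (x∉A ∘ there) (x∉B ∘ there)

interval-✶ : ∀ {n} {A B : Subset n} {x} → x ∉ˢ A → x ∈ˢ B → Vec.lookup (interval A B) x ≡ ✶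
interval-✶ {A = outside ∷ A} {_ ∷ B} _ here = refl
interval-✶ {A = inside ∷ A} {_ ∷ B} x∉A here = contradiction here x∉A
interval-✶ {A = _ ∷ A} {_ ∷ B} x∉A (there x∈B) = interval-✶ {A = A} {B} (x∉A ∘ there) x∈B

-- A point of A outside B′ is 𝟙 in the first word; A′ ⊆ B′ keeps it out of A′, so it is 𝟘 in the
-- second.
interval-↛ : ∀ {n} {A B A′ B′ : Subset n} → A′ ⊆ B′ → ¬ A ⊆ B′ → interval A B ↛ interval A′ B′
interval-↛ {A = A} {B} {A′} {B′} A′⊆B′ A⊈B′ =
  let x , x∈A , x∉B′ = ⊈⇒∃ A⊈B′ in
  x , interval-𝟙 {A = A} {B} x∈A , interval-𝟘 {A = A′} {B′} (x∉B′ ∘ A′⊆B′) x∉B′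

module _ {n m} {ps : List (Subset n × Subset n)} (ps! : Unique ps)
  (ordered : ∀ {p} → p ∈ ps → proj₁ p ⊆ proj₂ p)
  (separated : ∀ {p q} → p ∈ ps → q ∈ ps → proj₁ p ⊆ proj₂ q → p ≡ q)
  (small : ∀ {A B} → (A , B) ∈ ps → count 𝟙 (interval A B) + count 𝟘 (interval A B) ≤ m) where

  intervals-≤ : length ps ≤ m C ⌊ m /2⌋
  intervals-≤ = subst (_≤ m C ⌊ m /2⌋) (List.length-map word ps) (length-≤-C
    (All.map⁺ (All.tabulate small))
    (AllPairs.map⁺ (Unique⇒AllPairs ps! λ p∈ q∈ p≢q →
      interval-↛ (ordered q∈) (p≢q ∘ separated p∈ q∈) ,
      interval-↛ (ordered p∈) (p≢q ∘ sym ∘ separated q∈ p∈))))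
    where
    word : Subset n × Subset n → Word n
    word (A , B) = interval A B

sperner : ∀ {n} {F : Family n} → Unique F →
  (∀ {A B} → A ∈ F → B ∈ F → A ⊆ B → A ≡ B) → length F ≤ n C ⌊ n /2⌋
sperner {n} {F} F! antichain = subst (_≤ n C ⌊ n /2⌋) (List.length-map (λ A → A , A) F)
  (intervals-≤ (Unique.map⁺ (cong proj₁) F!)
    (λ p∈ → let _ , _ , e = ∈-map⁻ _ p∈ in subst (λ (A , B) → A ⊆ B) (sym e) id)
    (λ p∈ q∈ → sep (∈-map⁻ _ p∈) (∈-map⁻ _ q∈))
    (λ {A} {B} _ → ℕ.≤-trans (ℕ.m≤m+n _ _) (ℕ.≤-reflexive (count-total (interval A B)))))
  where
  sep : ∀ {p q} → (∃ λ A → A ∈ F × p ≡ (A , A)) → (∃ λ A → A ∈ F × q ≡ (A , A)) →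
        proj₁ p ⊆ proj₂ q → p ≡ q
  sep (A , A∈F , refl) (B , B∈F , refl) A⊆B = cong (λ A → A , A) (antichain A∈F B∈F A⊆B)

infix 4 _⊏_
_⊏_ : ∀ {n} → Subset n → Subset n → Set
A ⊏ B = A ⊆ B × A ≢ B

proper-intervals-≤ : ∀ {n} {ps : List (Subset n × Subset n)} → Unique ps →
  (∀ {A B} → (A , B) ∈ ps → A ⊏ B) →
  (∀ {p q} → p ∈ ps → q ∈ ps → proj₁ p ⊆ proj₂ q → p ≡ q) →
  length ps ≤ (n ∸ 1) C ⌊ n ∸ 1 /2⌋
proper-intervals-≤ {n} {ps} ps! proper separated = intervals-≤ ps! (λ p∈ → proj₁ (proper p∈)) separated small
  where
  -- A point of B outside A is marked ✶, and the three counts add up to n.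
  small : ∀ {A B} → (A , B) ∈ ps → count 𝟙 (interval A B) + count 𝟘 (interval A B) ≤ n ∸ 1
  small {A} {B} p∈ =
    let A⊆B , A≢B = proper p∈
        x , x∈B , x∉A = ⊈⇒∃ (A≢B ∘ Subset.⊆-antisym A⊆B)
        v = interval A B
    in ℕ.m+n≤o⇒m≤o∸n (count 𝟙 v + count 𝟘 v) (ℕ.≤-trans
         (ℕ.+-monoʳ-≤ (count 𝟙 v + count 𝟘 v) (lookup⇒0<count ✶ v x (interval-✶ {A = A} {B} x∉A x∈B)))
         (ℕ.≤-reflexive (count-total v)))

-- Subfamilies

∈-subfamilies⁻ : ∀ {n} (F : Family n) {G} → G ∈ subfamilies F → G ⊑ F
∈-subfamilies⁻ []      (here refl) = []
∈-subfamilies⁻ (X ∷ F) G∈ with ∈-++⁻ (subfamilies F) G∈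
... | inj₁ G∈F = X ∷ʳ ∈-subfamilies⁻ F G∈F
... | inj₂ G∈X∷F with ∈-map⁻ (X ∷_) G∈X∷F
...   | G′ , G′∈F , refl = refl ∷ ∈-subfamilies⁻ F G′∈F

∈-subfamilies⁺ : ∀ {n} {F G : Family n} → G ⊑ F → G ∈ subfamilies F
∈-subfamilies⁺ []                    = here refl
∈-subfamilies⁺ (X ∷ʳ G⊑F)            = ∈-++⁺ˡ (∈-subfamilies⁺ G⊑F)
∈-subfamilies⁺ {F = X ∷ F} (refl ∷ G⊑F) = ∈-++⁺ʳ (subfamilies F) (∈-map⁺ (X ∷_) (∈-subfamilies⁺ G⊑F))

subfamilies-Unique : ∀ {n} {F : Family n} → Unique F → Unique (subfamilies F)
subfamilies-Unique []                  = [] ∷ []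
subfamilies-Unique {F = X ∷ F} (X∉F ∷ F!) = Unique.++⁺ (subfamilies-Unique F!)
  (Unique.map⁺ List.∷-injectiveʳ (subfamilies-Unique F!)) disjoint
  where
  disjoint : ∀ {G} → ¬ (G ∈ subfamilies F × G ∈ map (X ∷_) (subfamilies F))
  disjoint (G∈F , G∈X∷F) with ∈-map⁻ (X ∷_) G∈X∷F
  ... | G′ , _ , refl = All.lookup X∉F (Sublist.lookup (∈-subfamilies⁻ F G∈F) (here refl)) refl

subsets-Unique : ∀ n → Unique (subsets n)
subsets-Unique zero    = [] ∷ []
subsets-Unique (suc n) = Unique.++⁺
  (Unique.map⁺ Vec.∷-injectiveʳ (subsets-Unique n)) (Unique.map⁺ Vec.∷-injectiveʳ (subsets-Unique n)) disjoint
  where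
  disjoint : ∀ {A} → ¬ (A ∈ map (outside ∷_) (subsets n) × A ∈ map (inside ∷_) (subsets n))
  disjoint (A∈out , A∈in) with ∈-map⁻ _ A∈out | ∈-map⁻ _ A∈in
  ... | _ , _ , refl | _ , _ , ()

∈-subsets : ∀ {n} (A : Subset n) → A ∈ subsets n
∈-subsets []            = here refl
∈-subsets (outside ∷ A) = ∈-++⁺ˡ (∈-map⁺ _ (∈-subsets A))
∈-subsets (inside ∷ A)  = ∈-++⁺ʳ (map (outside ∷_) (subsets _)) (∈-map⁺ _ (∈-subsets A))

⊑-Unique : ∀ {A : Set} {xs ys : List A} → xs ⊑ ys → Unique ys → Unique xs
⊑-Unique []            []          = []
⊑-Unique (_ ∷ʳ xs⊑ys)   (_ ∷ ys!)   = ⊑-Unique xs⊑ys ys!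
⊑-Unique (refl ∷ xs⊑ys) (y∉ ∷ ys!)  = Sublist.All-resp-⊆ xs⊑ys y∉ ∷ ⊑-Unique xs⊑ys ys!

-- Subfamilies are lists but are known only through their members. Inside a duplicate-free zs the
-- order of the entries is forced, so the members decide the list.
⊑-ext : ∀ {A : Set} {xs ys zs : List A} → Unique zs → xs ⊑ zs → ys ⊑ zs →
  (∀ {x} → x ∈ xs → x ∈ ys) → (∀ {x} → x ∈ ys → x ∈ xs) → xs ≡ ys
⊑-ext _ [] [] _ _ = refl
⊑-ext (z∉ ∷ zs!) (z ∷ʳ xs⊑) (.z ∷ʳ ys⊑) xs⇒ys ys⇒xs = ⊑-ext zs! xs⊑ ys⊑ xs⇒ys ys⇒xs
⊑-ext (z∉ ∷ zs!) (z ∷ʳ xs⊑) (refl ∷ ys⊑) xs⇒ys ys⇒xs =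
  contradiction refl (All.lookup z∉ (Sublist.lookup xs⊑ (ys⇒xs (here refl))))
⊑-ext (z∉ ∷ zs!) (refl ∷ xs⊑) (z ∷ʳ ys⊑) xs⇒ys ys⇒xs =
  contradiction refl (All.lookup z∉ (Sublist.lookup ys⊑ (xs⇒ys (here refl))))
⊑-ext {xs = z ∷ xs} {_ ∷ ys} (z∉ ∷ zs!) (refl ∷ xs⊑) (refl ∷ ys⊑) xs⇒ys ys⇒xs =
  cong (z ∷_) (⊑-ext zs! xs⊑ ys⊑
    (λ x∈ → strip xs⊑ x∈ (xs⇒ys (there x∈)))
    (λ y∈ → strip ys⊑ y∈ (ys⇒xs (there y∈))))
  where
  strip : ∀ {us vs x} → us ⊑ _ → x ∈ us → x ∈ z ∷ vs → x ∈ vs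
  strip us⊑ x∈us (here refl) = contradiction refl (All.lookup z∉ (Sublist.lookup us⊑ x∈us))
  strip us⊑ x∈us (there x∈) = x∈

length-filter-map : ∀ {A B : Set} {P : Pred B 0ℓ} {Q : Pred A 0ℓ}
  (P? : Decidable P) (Q? : Decidable Q) (f : A → B) →
  (∀ {x} → P (f x) → Q x) → (∀ {x} → Q x → P (f x)) →
  ∀ xs → length (filter P? (map f xs)) ≡ length (filter Q? xs)
length-filter-map P? Q? f P⇒Q Q⇒P [] = refl
length-filter-map P? Q? f P⇒Q Q⇒P (x ∷ xs) with P? (f x) | Q? x
... | yes _ | yes _ = cong suc (length-filter-map P? Q? f P⇒Q Q⇒P xs)
... | no  _ | no  _ = length-filter-map P? Q? f P⇒Q Q⇒P xs
... | yes p | no ¬q = contradiction (P⇒Q p) ¬q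
... | no ¬p | yes q = contradiction (Q⇒P q) ¬p

ofLength? : ∀ {A : Set} r (xs : List A) → Dec (length xs ≡ r)
ofLength? r xs = length xs ℕ.≟ r

subfamilies-of : ∀ {n} → ℕ → Family n → List (Family n)
subfamilies-of r F = filter (ofLength? r) (subfamilies F)

-- Pascal's rule, according to whether the first member X is taken.
length-subfamilies-of : ∀ {n} r (F : Family n) → length (subfamilies-of r F) ≡ length F C r
length-subfamilies-of zero    []      = refl
length-subfamilies-of (suc r) []      = refl
length-subfamilies-of r       (X ∷ F) = trans
  (cong length (List.filter-++ (ofLength? r) (subfamilies F) _))
  (trans (List.length-++ (subfamilies-of r F)) (split r))
  where
  with-X : ℕ → List (Family _)
  with-X r = filter (ofLength? r) (map (X ∷_) (subfamilies F))
  split : ∀ r → length (subfamilies-of r F) + length (with-X r) ≡ suc (length F) C r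
  split zero = cong₂ _+_ (length-subfamilies-of zero F)
    (cong length (List.filter-none (ofLength? 0) (All.map⁺ (All.tabulate {xs = subfamilies F} λ _ ()))))
  split (suc r) = begin
    length (subfamilies-of (suc r) F) + length (with-X (suc r))
      ≡⟨ cong₂ _+_ (length-subfamilies-of (suc r) F)
           (length-filter-map (ofLength? (suc r)) (ofLength? r) (X ∷_) ℕ.suc-injective (cong suc) (subfamilies F)) ⟩
    (length F C suc r) + length (subfamilies-of r F)
      ≡⟨ cong ((length F C suc r) +_) (length-subfamilies-of r F) ⟩
    (length F C suc r) + (length F C r)
      ≡⟨ ℕ.+-comm (length F C suc r) _ ⟩
    (length F C r) + (length F C suc r)
      ≡⟨ nCk+nC[k+1]≡[n+1]C[k+1] (length F) r ⟩
    suc (length F) C suc r ∎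
    where open ≡-Reasoning

ofSize? : ∀ {n} k (A : Subset n) → Dec (∣ A ∣ ≡ k)
ofSize? k A = ∣ A ∣ ℕ.≟ k

layer : ∀ n → ℕ → Family n
layer n k = filter (ofSize? k) (subsets n)

length-layer : ∀ n k → length (layer n k) ≡ n C k
length-layer zero    zero    = refl
length-layer zero    (suc k) = refl
length-layer (suc n) k       = trans
  (cong length (List.filter-++ (ofSize? k) (map (outside ∷_) (subsets n)) _))
  (trans (List.length-++ (part outside k)) (split k))
  where
  part : _ → ℕ → Family (suc n)
  part s k = filter (ofSize? k) (map (s ∷_) (subsets n))
  length-outside : ∀ k → length (part outside k) ≡ n C k
  length-outside k = trans
    (length-filter-map (ofSize? k) (ofSize? k) (outside ∷_) id id (subsets n)) (length-layer n k)
  split : ∀ k → length (part outside k) + length (part inside k) ≡ suc n C k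
  split zero = cong₂ _+_ (length-outside zero)
    (cong length (List.filter-none (ofSize? 0) (All.map⁺ (All.tabulate {xs = subsets n} λ _ ()))))
  split (suc k) = begin
    length (part outside (suc k)) + length (part inside (suc k))
      ≡⟨ cong₂ _+_ (length-outside (suc k))
           (length-filter-map (ofSize? (suc k)) (ofSize? k) (inside ∷_) ℕ.suc-injective (cong suc) (subsets n)) ⟩
    (n C suc k) + length (layer n k)
      ≡⟨ cong ((n C suc k) +_) (length-layer n k) ⟩
    (n C suc k) + (n C k)
      ≡⟨ ℕ.+-comm (n C suc k) _ ⟩
    (n C k) + (n C suc k)
      ≡⟨ nCk+nC[k+1]≡[n+1]C[k+1] n k ⟩
    suc n C suc k ∎
    where open ≡-Reasoning

-- Copies as embeddings

-- `IsCopyMap` without `onto`, with values in the ambient family: freeness and constructions can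
-- then be handled without naming the subfamily, which is the image.
record Embedding (P : FinPoset) {n} (F : Family n) (φ : Fin (FinPoset.size P) → Subset n) : Set where
  open FinPoset P using () renaming (_≤_ to _≤ₚ_)
  field
    injective : Injective _≡_ _≡_ φ
    into      : ∀ x → φ x ∈ F
    monotone  : ∀ {x y} → x ≤ₚ y → φ x ⊆ φ y

  strict : ∀ {x y} → x ≤ₚ y → x ≢ y → φ x ⊏ φ y
  strict x≤y x≢y = monotone x≤y , x≢y ∘ injective

copiesOf : (P : FinPoset) → ∀ {n} → Family n → List (Family n)
copiesOf P F = filter (isCopy? P) (subfamilies F)

-- Filtered out of F rather than tabulated, so that it is a sublist of F and hence an entry of
-- `subfamilies F`.
image : ∀ {n k} → Family n → (Fin k → Subset n) → Family n
image F φ = filter (λ X → Fin.any? λ x → φ x ≟ˢ X) F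

∈-image⁺ : ∀ {n k} (F : Family n) (φ : Fin k → Subset n) {x} → φ x ∈ F → φ x ∈ image F φ
∈-image⁺ F φ {x} φx∈F = ∈-filter⁺ _ φx∈F (x , refl)

∈-image⁻ : ∀ {n k} (F : Family n) (φ : Fin k → Subset n) {X} → X ∈ image F φ → ∃ λ x → φ x ≡ X
∈-image⁻ F φ X∈ = proj₂ (∈-filter⁻ (λ X → Fin.any? λ x → φ x ≟ˢ X) {xs = F} X∈)

module _ (P : FinPoset) {n} (F : Family n) where

  image∈copiesOf : ∀ {φ} → Embedding P F φ → image F φ ∈ copiesOf P F
  image∈copiesOf {φ} e = ∈-filter⁺ (isCopy? P) (∈-subfamilies⁺ (Sublist.filter-⊆ _ F)) (φ , record
    { injective = injective
    ; into      = λ x → ∈-image⁺ F φ (into x)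
    ; onto      = ∈-image⁻ F φ
    ; monotone  = monotone
    })
    where open Embedding e

  copiesOf⇒⊑ : ∀ {G} → G ∈ copiesOf P F → G ⊑ F
  copiesOf⇒⊑ G∈ = ∈-subfamilies⁻ F (proj₁ (∈-filter⁻ (isCopy? P) {xs = subfamilies F} G∈))

  copiesOf⇒Embedding : ∀ {G} → G ∈ copiesOf P F → ∃ λ φ → Embedding P F φ × IsCopyMap P G φ
  copiesOf⇒Embedding G∈ with proj₂ (∈-filter⁻ (isCopy? P) {xs = subfamilies F} G∈)
  ... | φ , c = φ , record
    { injective = injective
    ; into      = λ x → Sublist.lookup (copiesOf⇒⊑ G∈) (into x)
    ; monotone  = monotone
    } , c
    where open IsCopyMap c

  free⇒¬Embedding : copies P F ≡ 0 → ∀ {φ} → ¬ Embedding P F φ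
  free⇒¬Embedding none e with copiesOf P F | none | image∈copiesOf e
  ... | [] | _ | ()

  ¬Embedding⇒free : (∀ {φ} → ¬ Embedding P F φ) → copies P F ≡ 0
  ¬Embedding⇒free ¬e with copiesOf P F in eq
  ... | []    = refl
  ... | G ∷ _ = contradiction (proj₁ (proj₂ (copiesOf⇒Embedding (subst (G ∈_) (sym eq) (here refl))))) ¬e

  copiesOf-Unique : Unique F → Unique (copiesOf P F)
  copiesOf-Unique F! = Unique.filter⁺ (isCopy? P) (subfamilies-Unique F!)

-- Counting copies through their cores

length-enumerated : ∀ {A : Set} {r} {xs : List A} {ψ : Fin r → A} → Unique xs → Injective _≡_ _≡_ ψ →
  (∀ i → ψ i ∈ xs) → (∀ {x} → x ∈ xs → ∃ λ i → ψ i ≡ x) → length xs ≡ r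
length-enumerated {A} {r} {xs} {ψ} xs! ψ-inj into onto = trans
  (ℕ.≤-antisym
    (length-≤ _≡_ xs!
      (λ x∈ → let i , e = onto x∈ in _ , subst (_∈ tabulate ψ) e (∈-tabulate⁺ i) , refl)
      (λ _ _ p q → trans p (sym q)))
    (length-≤ _≡_ (Unique.tabulate⁺ ψ-inj)
      (λ x∈ → let i , e = ∈-tabulate⁻ x∈ in _ , subst (_∈ xs) (sym e) (into i) , refl)
      (λ _ _ p q → trans p (sym q))))
  (List.length-tabulate ψ)

enumerate : ∀ {A : Set} {r} {xs : List A} → Unique xs → length xs ≡ r → ∃ λ (ψ : Fin r → A) →
  Injective _≡_ _≡_ ψ × (∀ i → ψ i ∈ xs) × (∀ {x} → x ∈ xs → ∃ λ i → ψ i ≡ x)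
enumerate {xs = xs} xs! refl =
  lookup xs , lookup-injective xs! , ∈-lookup , λ x∈ → Any.index x∈ , sym (lookup-index x∈)

-- The elements `ι i` are the core of Q. `Mid` speaks of sets, not of positions in a copy; when it
-- holds exactly at core positions, `filter mid? G` is the core of a copy G, whichever map realises
-- G.
module Core {n} {F : Family n} (F! : Unique F) (Q : FinPoset) {r} (ι : Fin r → Fin (FinPoset.size Q))
  {Mid : Pred (Subset n) 0ℓ} (mid? : Decidable Mid) where

  NonCore : Fin (FinPoset.size Q) → Set
  NonCore x = ∀ i → ι i ≢ x

  core? : ∀ x → (∃ λ i → ι i ≡ x) ⊎ NonCore x
  core? x with Fin.any? (λ i → ι i Fin.≟ x)
  ... | yes c = inj₁ c
  ... | no ¬c = inj₂ λ i e → ¬c (i , e)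

  mid! : Unique (filter mid? F)
  mid! = Unique.filter⁺ mid? F!

  filter-mid-⊑ : ∀ {G} → G ⊑ F → filter mid? G ⊑ filter mid? F
  filter-mid-⊑ = Sublist.filter⁺ mid? mid? (λ { refl → id })

  -- Sending G to `filter mid? G` maps the copies to r-subsets of an antichain, and it is injective
  -- because one shared core member forces the other members to agree. Two maps may list the core in
  -- different orders, hence separate i and j.
  copies-≤ : Fin r → Injective _≡_ _≡_ ι →
    (∀ {A B} → A ∈ F → B ∈ F → Mid A → Mid B → A ⊆ B → A ≡ B) →
    (∀ {φ} → Embedding Q F φ → ∀ i → Mid (φ (ι i))) →
    (∀ {φ x} → Embedding Q F φ → NonCore x → ¬ Mid (φ x)) →
    (∀ {φ φ′ x i j} → Embedding Q F φ → Embedding Q F φ′ → φ (ι i) ≡ φ′ (ι j) → NonCore x → φ x ≡ φ′ x) →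
    copies Q F ≤ (n C ⌊ n /2⌋) C r
  copies-≤ i₀ ι-inj antichain core-mid non-core-mid determined = ℕ.≤-trans
    (length-≤ (λ G S → filter mid? G ≡ S) {ys = subfamilies-of r (filter mid? F)} (copiesOf-Unique Q F F!)
      (λ {G} G∈ → filter mid? G ,
        ∈-filter⁺ (ofLength? r) (∈-subfamilies⁺ (filter-mid-⊑ (copiesOf⇒⊑ Q F G∈))) (size G∈) , refl)
      (λ G∈ G′∈ e e′ → ⊑-ext F! (copiesOf⇒⊑ Q F G∈) (copiesOf⇒⊑ Q F G′∈)
        (incl G∈ G′∈ (trans e (sym e′))) (incl G′∈ G∈ (trans e′ (sym e)))))
    (ℕ.≤-trans (ℕ.≤-reflexive (length-subfamilies-of r (filter mid? F)))
      (C-monoˡ r (sperner mid! λ A∈ B∈ →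
        let A∈F , A-mid = ∈-filter⁻ mid? A∈ ; B∈F , B-mid = ∈-filter⁻ mid? B∈
        in antichain A∈F B∈F A-mid B-mid)))
    where
    size : ∀ {G} → G ∈ copiesOf Q F → length (filter mid? G) ≡ r
    size {G} G∈ with copiesOf⇒Embedding Q F G∈
    ... | φ , e , c = length-enumerated {ψ = φ ∘ ι}
      (Unique.filter⁺ mid? (⊑-Unique (copiesOf⇒⊑ Q F G∈) F!))
      (ι-inj ∘ Embedding.injective e)
      (λ i → ∈-filter⁺ mid? (IsCopyMap.into c (ι i)) (core-mid e i))
      onto
      where
      onto : ∀ {X} → X ∈ filter mid? G → ∃ λ i → φ (ι i) ≡ X
      onto X∈ with ∈-filter⁻ mid? X∈
      ... | X∈G , X-mid with IsCopyMap.onto c X∈G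
      ...   | x , refl with core? x
      ...     | inj₁ (i , refl) = i , refl
      ...     | inj₂ nc = contradiction X-mid (non-core-mid e nc)

    incl : ∀ {G G′} → G ∈ copiesOf Q F → G′ ∈ copiesOf Q F → filter mid? G ≡ filter mid? G′ →
           ∀ {X} → X ∈ G → X ∈ G′
    incl {G} {G′} G∈ G′∈ same X∈G with copiesOf⇒Embedding Q F G∈ | copiesOf⇒Embedding Q F G′∈
    ... | φ , e , c | φ′ , e′ , c′ with IsCopyMap.onto c X∈G
    ...   | x , refl with core? x
    ...     | inj₁ (i , refl) = proj₁ (∈-filter⁻ mid? (subst (_ ∈_) same (∈-filter⁺ mid? X∈G (core-mid e i))))
    -- The comparison of a non-core member goes through the core member at `i₀`: it lies in G′ as
    -- well and, being `Mid`, occupies some core position j there.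
    ...     | inj₂ nc with ∈-filter⁻ mid? {xs = G′}
                             (subst (_ ∈_) same (∈-filter⁺ mid? (IsCopyMap.into c (ι i₀)) (core-mid e i₀)))
    ...       | X₀∈G′ , X₀-mid with IsCopyMap.onto c′ X₀∈G′
    ...         | y , eq with core? y
    ...           | inj₁ (j , refl) = subst (_∈ G′) (sym (determined e e′ (sym eq) nc)) (IsCopyMap.into c′ x)
    ...           | inj₂ nc′ = contradiction (subst Mid (sym eq) X₀-mid) (non-core-mid e′ nc′)

  -- `filter mid?` recovers an r-set from the copy built on it, so different r-sets give different
  -- copies.
  copies-≥ :
    (∀ {ψ : Fin r → Subset n} → Injective _≡_ _≡_ ψ → (∀ i → ψ i ∈ filter mid? F) →
      ∃ λ φ → Embedding Q F φ × (∀ i → φ (ι i) ≡ ψ i) × (∀ {x} → NonCore x → ¬ Mid (φ x))) →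
    length (filter mid? F) C r ≤ copies Q F
  copies-≥ extend = ℕ.≤-trans (ℕ.≤-reflexive (sym (length-subfamilies-of r (filter mid? F))))
    (length-≤ (λ S G → filter mid? G ≡ S) (Unique.filter⁺ _ (subfamilies-Unique mid!))
      build (λ _ _ e e′ → trans (sym e) e′))
    where
    build : ∀ {S} → S ∈ subfamilies-of r (filter mid? F) → ∃ λ G → G ∈ copiesOf Q F × filter mid? G ≡ S
    build {S} S∈ with ∈-filter⁻ (ofLength? r) {xs = subfamilies (filter mid? F)} S∈
    ... | S∈M , |S|≡r with ∈-subfamilies⁻ (filter mid? F) S∈M
    ... | S⊑M with enumerate (⊑-Unique S⊑M mid!) |S|≡r
    ... | ψ , ψ-inj , ψ-into , ψ-onto with extend ψ-inj (Sublist.lookup S⊑M ∘ ψ-into)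
    ... | φ , e , φι≗ψ , nc-mid = image F φ , image∈copiesOf Q F e ,
      ⊑-ext mid! (filter-mid-⊑ (Sublist.filter-⊆ _ F)) S⊑M to from
      where
      to : ∀ {X} → X ∈ filter mid? (image F φ) → X ∈ S
      to X∈ with ∈-filter⁻ mid? {xs = image F φ} X∈
      ... | X∈im , X-mid with ∈-image⁻ F φ X∈im
      ... | x , refl with core? x
      ... | inj₁ (i , refl) = subst (_∈ S) (sym (φι≗ψ i)) (ψ-into i)
      ... | inj₂ nc = contradiction X-mid (nc-mid nc)
      from : ∀ {X} → X ∈ S → X ∈ filter mid? (image F φ)
      from X∈S with ψ-onto X∈S
      ... | i , refl with ∈-filter⁻ mid? {xs = F} (Sublist.lookup S⊑M X∈S)
      ... | X∈F , X-mid = ∈-filter⁺ mid?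
        (subst (_∈ image F φ) (φι≗ψ i) (∈-image⁺ F φ (subst (_∈ F) (sym (φι≗ψ i)) X∈F))) X-mid

La-≡ : ∀ n 𝒫 Q {v} →
  (∀ {F} → Unique F → All (λ P → copies P F ≡ 0) 𝒫 → copies Q F ≤ v) →
  (∃ λ F → F ⊑ subsets n × All (λ P → copies P F ≡ 0) 𝒫 × v ≤ copies Q F) →
  La n 𝒫 (Q ∷ []) ≡ v
La-≡ n 𝒫 Q {v} upper (F , F⊑ , F-free , lower) = ℕ.≤-antisym
  (max≤v⁺ z≤n (All.map⁺ (All.tabulate bounded)))
  (v≤max⁺ 0 _ (inj₂ (Any.map (λ { refl → ℕ.≤-trans lower (ℕ.m≤m+n (copies Q F) 0) })
    (∈-map⁺ _ (∈-filter⁺ free? (∈-subfamilies⁺ F⊑) F-free)))))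
  where
  free? : Decidable (λ F → All (λ P → copies P {n} F ≡ 0) 𝒫)
  free? F = All.all? (λ P → copies P F ℕ.≟ 0) 𝒫
  bounded : ∀ {F} → F ∈ freeFamilies n 𝒫 → copies Q F + 0 ≤ v
  bounded {F} F∈ =
    let F∈s , free = ∈-filter⁻ free? {xs = subfamilies (subsets n)} F∈
    in ℕ.≤-trans (ℕ.≤-reflexive (ℕ.+-identityʳ (copies Q F)))
         (upper (⊑-Unique (∈-subfamilies⁻ (subsets n) F∈s) (subsets-Unique n)) free)

-- Upper bounds

⊏-trans : ∀ {n} {A B C : Subset n} → A ⊏ B → B ⊏ C → A ⊏ C
⊏-trans (A⊆B , A≢B) (B⊆C , _) = B⊆C ∘ A⊆B , λ { refl → A≢B (Subset.⊆-antisym A⊆B B⊆C) }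

_⊏?_ : ∀ {n} (A B : Subset n) → Dec (A ⊏ B)
A ⊏? B = (A Subset.⊆? B) ×-dec ¬? (A ≟ˢ B)

⊆⇒⊏∨≡ : ∀ {n} {A B : Subset n} → A ⊆ B → A ⊏ B ⊎ A ≡ B
⊆⇒⊏∨≡ {A = A} {B} A⊆B with A ≟ˢ B
... | yes A≡B = inj₂ A≡B
... | no  A≢B = inj₁ (A⊆B , A≢B)

⊏⇒∣<∣ : ∀ {n} {A B : Subset n} → A ⊏ B → ∣ A ∣ < ∣ B ∣
⊏⇒∣<∣ (A⊆B , A≢B) =
  let x , x∈B , x∉A = ⊈⇒∃ (A≢B ∘ Subset.⊆-antisym A⊆B)
  in Subset.p⊂q⇒∣p∣<∣q∣ (A⊆B , x , x∈B , x∉A)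

either : ∀ {P Q : Set} → Dec P → Dec Q → (¬ P → ¬ ¬ Q) → P ⊎ Q
either (yes p) _       _ = inj₁ p
either (no _)  (yes q) _ = inj₂ q
either (no ¬p) (no ¬q) f = contradiction ¬q (f ¬p)

module _ {n} {F : Family n} where

  ⋁-free⇒unique-above : copies (⋁ 2) F ≡ 0 →
    ∀ {A B C} → A ∈ F → B ∈ F → C ∈ F → A ⊏ B → A ⊏ C → B ≡ C
  ⋁-free⇒unique-above free {A} {B} {C} A∈F B∈F C∈F (A⊆B , A≢B) (A⊆C , A≢C) =
    decidable-stable (B ≟ˢ C) λ B≢C → free⇒¬Embedding (⋁ 2) F free {lookup (A ∷ B ∷ C ∷ [])} record
    { injective = lookup-injective ((A≢B ∷ A≢C ∷ []) ∷ (B≢C ∷ []) ∷ [] ∷ [])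
    ; into      = λ x → All.lookup {xs = A ∷ B ∷ C ∷ []} (A∈F ∷ B∈F ∷ C∈F ∷ []) (∈-lookup x)
    ; monotone  = monotone
    }
    where
    monotone : ∀ {x y} → FinPoset._≤_ (⋁ 2) x y → lookup (A ∷ B ∷ C ∷ []) x ⊆ lookup (A ∷ B ∷ C ∷ []) y
    monotone (inj₁ refl) = id
    monotone {y = zero}          (inj₂ refl) = id
    monotone {y = suc zero}      (inj₂ refl) = A⊆B
    monotone {y = suc (suc zero)} (inj₂ refl) = A⊆C

  ⋀-free⇒unique-below : copies (⋀ 2) F ≡ 0 →
    ∀ {A B C} → A ∈ F → B ∈ F → C ∈ F → B ⊏ A → C ⊏ A → B ≡ C
  ⋀-free⇒unique-below free {A} {B} {C} A∈F B∈F C∈F (B⊆A , B≢A) (C⊆A , C≢A) =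
    decidable-stable (B ≟ˢ C) λ B≢C → free⇒¬Embedding (⋀ 2) F free {lookup (B ∷ C ∷ A ∷ [])} record
    { injective = lookup-injective ((B≢C ∷ B≢A ∷ []) ∷ (C≢A ∷ []) ∷ [] ∷ [])
    ; into      = λ x → All.lookup {xs = B ∷ C ∷ A ∷ []} (B∈F ∷ C∈F ∷ A∈F ∷ []) (∈-lookup x)
    ; monotone  = monotone
    }
    where
    monotone : ∀ {x y} → FinPoset._≤_ (⋀ 2) x y → lookup (B ∷ C ∷ A ∷ []) x ⊆ lookup (B ∷ C ∷ A ∷ []) y
    monotone (inj₁ refl) = id
    monotone {zero}           (inj₂ refl) = B⊆A
    monotone {suc zero}       (inj₂ refl) = C⊆A
    monotone {suc (suc zero)} (inj₂ refl) = id

  butterfly-free⇒≡ : copies butterfly F ≡ 0 → ∀ {A B C D} → A ∈ F → B ∈ F → C ∈ F → D ∈ F →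
    A ⊏ C → A ⊏ D → B ⊏ C → B ⊏ D → A ≡ B ⊎ C ≡ D
  butterfly-free⇒≡ free {A} {B} {C} {D} A∈F B∈F C∈F D∈F (A⊆C , A≢C) (A⊆D , A≢D) (B⊆C , B≢C) (B⊆D , B≢D) =
    either (A ≟ˢ B) (C ≟ˢ D) λ A≢B C≢D → free⇒¬Embedding butterfly F free {lookup (A ∷ B ∷ C ∷ D ∷ [])} record
    { injective = lookup-injective ((A≢B ∷ A≢C ∷ A≢D ∷ []) ∷ (B≢C ∷ B≢D ∷ []) ∷ (C≢D ∷ []) ∷ [] ∷ [])
    ; into      = λ x → All.lookup {xs = A ∷ B ∷ C ∷ D ∷ []} (A∈F ∷ B∈F ∷ C∈F ∷ D∈F ∷ []) (∈-lookup x)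
    ; monotone  = monotone
    }
    where
    monotone : ∀ {x y} → FinPoset._≤_ butterfly x y →
               lookup (A ∷ B ∷ C ∷ D ∷ []) x ⊆ lookup (A ∷ B ∷ C ∷ D ∷ []) y
    monotone (inj₁ refl) = id
    monotone {zero}        {suc (suc zero)}       (inj₂ _) = A⊆C
    monotone {zero}        {suc (suc (suc zero))} (inj₂ _) = A⊆D
    monotone {suc zero}    {suc (suc zero)}       (inj₂ _) = B⊆C
    monotone {suc zero}    {suc (suc (suc zero))} (inj₂ _) = B⊆D
    monotone {_}           {zero}                 (inj₂ (_ , ()))
    monotone {_}           {suc zero}             (inj₂ (_ , s≤s ()))
    monotone {suc (suc _)} {_}                    (inj₂ (s≤s (s≤s ()) , _))

-- ⋀ᵣ and ⋁ᵣ are treated at once, _◁_ being _⊏_ or its converse.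
module Star {n} {F : Family n} (F! : Unique F) (Q : FinPoset) {r} (ι : Fin r → Fin (FinPoset.size Q))
  (apex : Fin (FinPoset.size Q)) (_◁_ : Subset n → Subset n → Set) (_◁?_ : ∀ A B → Dec (A ◁ B))
  (◁-trans : ∀ {A B C} → A ◁ B → B ◁ C → A ◁ C) (◁⇒≢ : ∀ {A B} → A ◁ B → A ≢ B)
  (⊏⇒◁ : ∀ {A B} → A ⊏ B → A ◁ B ⊎ B ◁ A)
  (◁-unique : ∀ {A B C} → A ∈ F → B ∈ F → C ∈ F → A ◁ B → A ◁ C → B ≡ C)
  (shape : ∀ {x} → (∀ i → ι i ≢ x) → x ≡ apex)
  (◁-apex : ∀ {φ} → Embedding Q F φ → ∀ i → φ (ι i) ◁ φ apex) where

  -- Tells the leaves from the apex: a leaf has the apex beyond it, while a set beyond the apex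
  -- would complete a 3-chain.
  HasAbove : Subset n → Set
  HasAbove A = Any (A ◁_) F

  open Core F! Q ι {HasAbove} (λ A → Any.any? (A ◁?_) F)

  ¬3-chain : ∀ {A B C} → A ∈ F → B ∈ F → C ∈ F → A ◁ B → ¬ B ◁ C
  ¬3-chain A∈F B∈F C∈F A◁B B◁C = ◁⇒≢ B◁C (◁-unique A∈F B∈F C∈F A◁B (◁-trans A◁B B◁C))

  star-copies-≤ : Fin r → Injective _≡_ _≡_ ι → copies Q F ≤ (n C ⌊ n /2⌋) C r
  star-copies-≤ i₀ ι-inj = copies-≤ i₀ ι-inj antichain
    (λ e i → Any.map (λ { refl → ◁-apex e i }) (Embedding.into e apex))
    (λ {φ} e nc → subst (λ x → ¬ HasAbove (φ x)) (sym (shape nc)) λ above →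
      let open Embedding e ; C , C∈F , apex◁C = find above
      in ¬3-chain (into (ι i₀)) (into apex) C∈F (◁-apex e i₀) apex◁C)
    (λ {φ} {φ′} {i = i} {j} e e′ φι≡φ′ι nc → subst (λ x → φ x ≡ φ′ x) (sym (shape nc))
      (◁-unique (Embedding.into e (ι i)) (Embedding.into e apex) (Embedding.into e′ apex) (◁-apex e i)
        (subst (_◁ _) (sym φι≡φ′ι) (◁-apex e′ j))))
    where
    antichain : ∀ {A B} → A ∈ F → B ∈ F → HasAbove A → HasAbove B → A ⊆ B → A ≡ B
    antichain A∈F B∈F above-A above-B A⊆B with ⊆⇒⊏∨≡ A⊆B | find above-A | find above-B
    ... | inj₂ A≡B | _ | _ = A≡B
    ... | inj₁ A⊏B | C , C∈F , A◁C | D , D∈F , B◁D with ⊏⇒◁ A⊏B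
    ...   | inj₁ A◁B = contradiction B◁D (¬3-chain A∈F B∈F D∈F A◁B)
    ...   | inj₂ B◁A = contradiction A◁C (¬3-chain B∈F A∈F C∈F B◁A)

⋀-shape : ∀ {r x} → (∀ (i : Fin r) → inject₁ i ≢ x) → x ≡ fromℕ r
⋀-shape {x = x} nc with view x
... | ‵fromℕ       = refl
... | ‵inj₁ {i = i} _ = contradiction refl (nc i)

⋁-shape : ∀ {r x} → (∀ (i : Fin r) → Fin.suc i ≢ x) → x ≡ zero
⋁-shape {x = zero}  nc = refl
⋁-shape {x = suc x} nc = contradiction refl (nc x)

⋁-free⇒⋀-copies-≤ : ∀ {n r} {F : Family n} → Unique F → 1 ≤ r → copies (⋁ 2) F ≡ 0 →
  copies (⋀ r) F ≤ (n C ⌊ n /2⌋) C r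
⋁-free⇒⋀-copies-≤ {r = suc r} {F} F! _ free = Star.star-copies-≤ F! (⋀ (suc r)) inject₁ (fromℕ (suc r))
  _⊏_ _⊏?_ ⊏-trans proj₂ inj₁ (⋁-free⇒unique-above free) ⋀-shape
  (λ e i → Embedding.strict e (inj₂ refl) (Fin.fromℕ≢inject₁ ∘ sym)) zero Fin.inject₁-injective

⋀-free⇒⋁-copies-≤ : ∀ {n r} {F : Family n} → Unique F → 1 ≤ r → copies (⋀ 2) F ≡ 0 →
  copies (⋁ r) F ≤ (n C ⌊ n /2⌋) C r
⋀-free⇒⋁-copies-≤ {r = suc r} {F} F! _ free = Star.star-copies-≤ F! (⋁ (suc r)) suc zero
  (λ A B → B ⊏ A) (λ A B → B ⊏? A) (λ A◁B B◁C → ⊏-trans B◁C A◁B) (λ A◁B → proj₂ A◁B ∘ sym) inj₂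
  (⋀-free⇒unique-below free) ⋁-shape
  (λ e i → Embedding.strict e (inj₂ refl) λ ()) zero Fin.suc-injective

ButterflyFree : ∀ {n} → Family n → Set
ButterflyFree F = ∀ {A B C D} → A ∈ F → B ∈ F → C ∈ F → D ∈ F →
  A ⊏ C → A ⊏ D → B ⊏ C → B ⊏ D → A ≡ B ⊎ C ≡ D

module Diamond {n} {F : Family n} (F! : Unique F) (free : ButterflyFree F) (r : ℕ) where

  Q : FinPoset
  Q = diamond (suc r)

  ι : Fin (suc r) → Fin (3 + r)
  ι i = suc (inject₁ i)

  top : Fin (3 + r)
  top = fromℕ (2 + r)

  -- Members at b₁, ..., b_r have those at a and c around them. With sets on both sides, the member
  -- at a or at c would be the second or the third set of a 4-chain.
  Between : Subset n → Set
  Between A = Any (_⊏ A) F × Any (A ⊏_) F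

  open Core F! Q ι {Between} (λ A → Any.any? (_⊏? A) F ×-dec Any.any? (A ⊏?_) F)

  -- A and B both lie below C and D, which is a butterfly unless C ≡ D.
  unique-above : ∀ {A B C D} → A ∈ F → B ∈ F → C ∈ F → D ∈ F → A ⊏ B → B ⊏ C → B ⊏ D → C ≡ D
  unique-above A∈F B∈F C∈F D∈F A⊏B B⊏C B⊏D
    with free A∈F B∈F C∈F D∈F (⊏-trans A⊏B B⊏C) (⊏-trans A⊏B B⊏D) B⊏C B⊏D
  ... | inj₁ A≡B = contradiction A≡B (proj₂ A⊏B)
  ... | inj₂ C≡D = C≡D

  unique-below : ∀ {A B C D} → A ∈ F → B ∈ F → C ∈ F → D ∈ F → A ⊏ C → B ⊏ C → C ⊏ D → A ≡ B
  unique-below A∈F B∈F C∈F D∈F A⊏C B⊏C C⊏D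
    with free A∈F B∈F C∈F D∈F A⊏C (⊏-trans A⊏C C⊏D) B⊏C (⊏-trans B⊏C C⊏D)
  ... | inj₁ A≡B = A≡B
  ... | inj₂ C≡D = contradiction C≡D (proj₂ C⊏D)

  ¬4-chain : ∀ {A B C D} → A ∈ F → B ∈ F → C ∈ F → D ∈ F → A ⊏ B → B ⊏ C → ¬ C ⊏ D
  ¬4-chain A∈F B∈F C∈F D∈F A⊏B B⊏C C⊏D =
    proj₂ C⊏D (unique-above A∈F B∈F C∈F D∈F A⊏B B⊏C (⊏-trans B⊏C C⊏D))

  shape : ∀ {x} → NonCore x → x ≡ zero ⊎ x ≡ top
  shape {zero}  nc = inj₁ refl
  shape {suc x} nc = inj₂ (cong suc (⋀-shape λ i e → nc i (cong suc e)))

  module _ {φ} (e : Embedding Q F φ) where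
    open Embedding e

    zero⊏ι : ∀ i → φ zero ⊏ φ (ι i)
    zero⊏ι i = strict (inj₂ (inj₁ refl)) λ ()

    ι⊏top : ∀ i → φ (ι i) ⊏ φ top
    ι⊏top i = strict (inj₂ (inj₂ refl)) (Fin.fromℕ≢inject₁ ∘ sym ∘ Fin.suc-injective)

    non-core-mid : ∀ {x} → x ≡ zero ⊎ x ≡ top → ¬ Between (φ x)
    non-core-mid (inj₁ refl) (below , _) =
      let A , A∈F , A⊏ = find below
      in ¬4-chain A∈F (into zero) (into (ι zero)) (into top) A⊏ (zero⊏ι zero) (ι⊏top zero)
    non-core-mid (inj₂ refl) (_ , above) =
      let D , D∈F , ⊏D = find above
      in ¬4-chain (into zero) (into (ι zero)) (into top) D∈F (zero⊏ι zero) (ι⊏top zero) ⊏D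

  determined : ∀ {φ φ′ x i j} → Embedding Q F φ → Embedding Q F φ′ → φ (ι i) ≡ φ′ (ι j) →
    x ≡ zero ⊎ x ≡ top → φ x ≡ φ′ x
  determined {i = i} {j} e e′ φι≡φ′ι (inj₁ refl) =
    unique-below (into e zero) (into e′ zero) (into e (ι i)) (into e top)
      (zero⊏ι e i) (subst (_ ⊏_) (sym φι≡φ′ι) (zero⊏ι e′ j)) (ι⊏top e i)
    where open Embedding
  determined {i = i} {j} e e′ φι≡φ′ι (inj₂ refl) =
    unique-above (into e zero) (into e (ι i)) (into e top) (into e′ top)
      (zero⊏ι e i) (ι⊏top e i) (subst (_⊏ _) (sym φι≡φ′ι) (ι⊏top e′ j))
    where open Embedding

  antichain : ∀ {A B} → A ∈ F → B ∈ F → Between A → Between B → A ⊆ B → A ≡ B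
  antichain A∈F B∈F (below-A , _) (_ , above-B) A⊆B with ⊆⇒⊏∨≡ A⊆B | find below-A | find above-B
  ... | inj₂ A≡B | _ | _ = A≡B
  ... | inj₁ A⊏B | C , C∈F , C⊏A | D , D∈F , B⊏D = contradiction B⊏D (¬4-chain C∈F A∈F B∈F D∈F C⊏A A⊏B)

  diamond-copies-≤ : copies Q F ≤ (n C ⌊ n /2⌋) C suc r
  diamond-copies-≤ = copies-≤ zero (Fin.inject₁-injective ∘ Fin.suc-injective) antichain
    (λ e i → let open Embedding e in
      Any.map (λ { refl → zero⊏ι e i }) (into zero) , Any.map (λ { refl → ι⊏top e i }) (into top))
    (λ e nc → non-core-mid e (shape nc))
    (λ e e′ φι≡φ′ι nc → determined e e′ φι≡φ′ι (shape nc))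

-- Extremal families

snoc : ∀ {A : Set} {r} → (Fin r → A) → A → Fin (suc r) → A
snoc {A} {r} ψ a x = at (view x)
  where
  at : ∀ {x} → View x → A
  at ‵fromℕ          = a
  at (‵inj₁ {i = i} _) = ψ i

module _ {A : Set} {r} (ψ : Fin r → A) (a : A) where

  snoc-fromℕ : snoc ψ a (fromℕ r) ≡ a
  snoc-fromℕ rewrite view-fromℕ r = refl

  snoc-inject₁ : ∀ i → snoc ψ a (inject₁ i) ≡ ψ i
  snoc-inject₁ i rewrite view-inject₁ i = refl

  snoc-all : (P : A → Set) → P a → (∀ i → P (ψ i)) → ∀ x → P (snoc ψ a x)
  snoc-all P Pa Pψ x with view x
  ... | ‵fromℕ          = Pa
  ... | ‵inj₁ {i = i} _ = Pψ i

  snoc-injective : Injective _≡_ _≡_ ψ → (∀ i → ψ i ≢ a) → Injective _≡_ _≡_ (snoc ψ a)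
  snoc-injective ψ-inj ψ≢a {x} {y} e with view x | view y
  ... | ‵fromℕ  | ‵fromℕ  = refl
  ... | ‵fromℕ  | ‵inj₁ {i = j} _ = contradiction (sym e) (ψ≢a j)
  ... | ‵inj₁ {i = i} _ | ‵fromℕ  = contradiction e (ψ≢a i)
  ... | ‵inj₁ _ | ‵inj₁ _ = cong inject₁ (ψ-inj e)

cons-injective : ∀ {A : Set} {r} {ψ : Fin r → A} {a} → Injective _≡_ _≡_ ψ → (∀ i → ψ i ≢ a) →
  Injective _≡_ _≡_ (a Vector.∷ ψ)
cons-injective ψ-inj ψ≢a {zero}  {zero}  _ = refl
cons-injective ψ-inj ψ≢a {zero}  {suc j} e = contradiction (sym e) (ψ≢a j)
cons-injective ψ-inj ψ≢a {suc i} {zero}  e = contradiction e (ψ≢a i)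
cons-injective ψ-inj ψ≢a {suc i} {suc j} e = cong suc (ψ-inj e)

-- The extra sets avoid size k, so that membership in the layer can serve as `Mid` for the copies
-- built on it.
module LayerPlus (n k : ℕ) (E : Family n) (E∌layer : All (λ A → ∣ A ∣ ≢ k) E) where
  open import Data.List.Membership.DecPropositional (_≟ˢ_ {n}) using (_∈?_)

  InLayer : Subset n → Set
  InLayer A = ∣ A ∣ ≡ k

  inLayer? : Decidable InLayer
  inLayer? = ofSize? k

  family? : Decidable (λ A → InLayer A ⊎ A ∈ E)
  family? A = inLayer? A ⊎-dec (A ∈? E)

  -- Filtered out of `subsets n`, since `La` ranges over sublists of it only.
  family : Family n
  family = filter family? (subsets n)

  family-⊑ : family ⊑ subsets n
  family-⊑ = Sublist.filter-⊆ family? (subsets n)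

  family! : Unique family
  family! = Unique.filter⁺ family? (subsets-Unique n)

  family⁻ : ∀ {A} → A ∈ family → InLayer A ⊎ A ∈ E
  family⁻ A∈ = proj₂ (∈-filter⁻ family? {xs = subsets n} A∈)

  extra∈family : ∀ {A} → A ∈ E → A ∈ family
  extra∈family A∈E = ∈-filter⁺ family? (∈-subsets _) (inj₂ A∈E)

  extra∉layer : ∀ {A} → A ∈ E → ¬ InLayer A
  extra∉layer = All.lookup E∌layer

  ∈layer⇒InLayer : ∀ {A} → A ∈ filter inLayer? family → InLayer A
  ∈layer⇒InLayer A∈ = proj₂ (∈-filter⁻ inLayer? {xs = family} A∈)

  ∈layer⇒∈family : ∀ {A} → A ∈ filter inLayer? family → A ∈ family
  ∈layer⇒∈family A∈ = proj₁ (∈-filter⁻ inLayer? {xs = family} A∈)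

  ∈layer⇒≢extra : ∀ {A B} → A ∈ filter inLayer? family → B ∈ E → A ≢ B
  ∈layer⇒≢extra A∈ B∈E refl = extra∉layer B∈E (∈layer⇒InLayer A∈)

  length-inLayer : length (filter inLayer? family) ≡ n C k
  length-inLayer = trans (cong length (⊑-ext (Unique.filter⁺ inLayer? (subsets-Unique n))
    (Sublist.filter⁺ inLayer? inLayer? (λ { refl → id }) family-⊑) ⊆-refl
    (λ A∈ → ∈-filter⁺ inLayer? (∈-subsets _) (∈layer⇒InLayer A∈))
    (λ A∈ → let A∈s , A∈L = ∈-filter⁻ inLayer? {xs = subsets n} A∈
            in ∈-filter⁺ inLayer? (∈-filter⁺ family? A∈s (inj₁ A∈L)) A∈L)))
    (length-layer n k)

  ⊏⇒extra : ∀ {A B} → A ∈ family → B ∈ family → A ⊏ B → A ∈ E ⊎ B ∈ E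
  ⊏⇒extra A∈ B∈ A⊏B with family⁻ A∈ | family⁻ B∈
  ... | inj₂ A∈E | _        = inj₁ A∈E
  ... | inj₁ _   | inj₂ B∈E = inj₂ B∈E
  ... | inj₁ ∣A∣≡k | inj₁ ∣B∣≡k = contradiction (trans ∣A∣≡k (sym ∣B∣≡k)) (ℕ.<⇒≢ (⊏⇒∣<∣ A⊏B))

∣⊤∣≢ : ∀ {n k} → k < n → ∣ ⊤ {n} ∣ ≢ k
∣⊤∣≢ {n} k<n e = ℕ.<⇒≢ k<n (trans (sym e) (Subset.∣⊤∣≡n n))

∣⊥∣≢ : ∀ {n k} → 0 < k → ∣ ⊥ {n} ∣ ≢ k
∣⊥∣≢ {n} 0<k e = ℕ.<⇒≢ 0<k (trans (sym (Subset.∣⊥∣≡0 n)) e)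

¬⊤⊏ : ∀ {n} {A : Subset n} → ¬ ⊤ ⊏ A
¬⊤⊏ (⊤⊆A , ⊤≢A) = ⊤≢A (Subset.⊆-antisym ⊤⊆A Subset.⊆⊤)

¬⊏⊥ : ∀ {n} {A : Subset n} → ¬ A ⊏ ⊥
¬⊏⊥ (A⊆⊥ , A≢⊥) = A≢⊥ (Subset.⊆-antisym A⊆⊥ Subset.⊥⊆)

module LayerPlus⊤ {n k : ℕ} (k<n : k < n) where
  open LayerPlus n k (⊤ ∷ []) (∣⊤∣≢ k<n ∷ []) public

  ⊏⇒≡⊤ : ∀ {A B} → A ∈ family → B ∈ family → A ⊏ B → B ≡ ⊤
  ⊏⇒≡⊤ A∈ B∈ A⊏B with ⊏⇒extra A∈ B∈ A⊏B
  ... | inj₁ (here refl) = contradiction A⊏B ¬⊤⊏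
  ... | inj₂ (here B≡⊤)  = B≡⊤

  ⋁-free : copies (⋁ 2) family ≡ 0
  ⋁-free = ¬Embedding⇒free (⋁ 2) family λ {φ} e →
    let open Embedding e
        a = zero ; b = suc zero ; c = suc (suc zero)
        φb≡⊤ = ⊏⇒≡⊤ (into a) (into b) (strict (inj₂ refl) λ ())
        φc≡⊤ = ⊏⇒≡⊤ (into a) (into c) (strict (inj₂ refl) λ ())
    in contradiction (injective {b} {c} (trans φb≡⊤ (sym φc≡⊤))) λ ()

  ⋀-copies-≥ : ∀ r → (n C k) C r ≤ copies (⋀ r) family
  ⋀-copies-≥ r = subst (λ N → N C r ≤ copies (⋀ r) family) length-inLayer
    (Core.copies-≥ family! (⋀ r) inject₁ inLayer? λ {ψ} ψ-inj ψ∈ → snoc ψ ⊤ , record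
      { injective = snoc-injective ψ ⊤ ψ-inj (λ i → ∈layer⇒≢extra (ψ∈ i) (here refl))
      ; into      = snoc-all ψ ⊤ (_∈ family) (extra∈family (here refl)) (∈layer⇒∈family ∘ ψ∈)
      ; monotone  = monotone ψ
      } , snoc-inject₁ ψ ⊤ , λ nc → subst (λ x → ¬ InLayer (snoc ψ ⊤ x)) (sym (⋀-shape nc))
        (subst (¬_ ∘ InLayer) (sym (snoc-fromℕ ψ ⊤)) (extra∉layer (here refl))))
    where
    monotone : ∀ ψ {x y} → FinPoset._≤_ (⋀ r) x y → snoc ψ ⊤ x ⊆ snoc ψ ⊤ y
    monotone ψ (inj₁ refl) = id
    monotone ψ {x} (inj₂ refl) = subst (snoc ψ ⊤ x ⊆_) (sym (snoc-fromℕ ψ ⊤)) Subset.⊆⊤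

module LayerPlus⊥ {n k : ℕ} (0<k : 0 < k) where
  open LayerPlus n k (⊥ ∷ []) (∣⊥∣≢ {n} 0<k ∷ []) public

  ⊏⇒≡⊥ : ∀ {A B} → A ∈ family → B ∈ family → A ⊏ B → A ≡ ⊥
  ⊏⇒≡⊥ A∈ B∈ A⊏B with ⊏⇒extra A∈ B∈ A⊏B
  ... | inj₁ (here A≡⊥)  = A≡⊥
  ... | inj₂ (here refl) = contradiction A⊏B ¬⊏⊥

  ⋀-free : copies (⋀ 2) family ≡ 0
  ⋀-free = ¬Embedding⇒free (⋀ 2) family λ {φ} e →
    let open Embedding e
        a = zero ; b = suc zero ; c = suc (suc zero)
        φa≡⊥ = ⊏⇒≡⊥ (into a) (into c) (strict (inj₂ refl) λ ())
        φb≡⊥ = ⊏⇒≡⊥ (into b) (into c) (strict (inj₂ refl) λ ())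
    in contradiction (injective {a} {b} (trans φa≡⊥ (sym φb≡⊥))) λ ()

  ⋁-copies-≥ : ∀ r → (n C k) C r ≤ copies (⋁ r) family
  ⋁-copies-≥ r = subst (λ N → N C r ≤ copies (⋁ r) family) length-inLayer
    (Core.copies-≥ family! (⋁ r) suc inLayer? λ {ψ} ψ-inj ψ∈ → ⊥ Vector.∷ ψ , record
      { injective = cons-injective ψ-inj (λ i → ∈layer⇒≢extra (ψ∈ i) (here refl))
      ; into      = λ { zero → extra∈family (here refl) ; (suc i) → ∈layer⇒∈family (ψ∈ i) }
      ; monotone  = monotone ψ
      } , (λ _ → refl) , λ nc → subst (λ x → ¬ InLayer ((⊥ Vector.∷ ψ) x)) (sym (⋁-shape nc))
        (extra∉layer (here refl)))
    where
    monotone : ∀ ψ {x y} → FinPoset._≤_ (⋁ r) x y → (⊥ Vector.∷ ψ) x ⊆ (⊥ Vector.∷ ψ) y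
    monotone ψ (inj₁ refl) = id
    monotone ψ (inj₂ refl) = Subset.⊥⊆

module LayerPlus⊥⊤ {n k : ℕ} (0<k : 0 < k) (k<n : k < n) where
  open LayerPlus n k (⊥ ∷ ⊤ ∷ []) (∣⊥∣≢ {n} 0<k ∷ ∣⊤∣≢ k<n ∷ []) public

  ⊏⇒≡⊥∨≡⊤ : ∀ {A B} → A ∈ family → B ∈ family → A ⊏ B → A ≡ ⊥ ⊎ B ≡ ⊤
  ⊏⇒≡⊥∨≡⊤ A∈ B∈ A⊏B with ⊏⇒extra A∈ B∈ A⊏B
  ... | inj₁ (here A≡⊥)          = inj₁ A≡⊥
  ... | inj₁ (there (here refl)) = contradiction A⊏B ¬⊤⊏
  ... | inj₂ (here refl)         = contradiction A⊏B ¬⊏⊥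
  ... | inj₂ (there (here B≡⊤))  = inj₂ B≡⊤

  -- B and C cannot both be ⊤, so one of the two comparisons must start at ⊥. In a butterfly this
  -- would make both lower members ⊥.
  ≡⊥ : ∀ {A B C} → A ∈ family → B ∈ family → C ∈ family → A ⊏ B → A ⊏ C → B ≢ C → A ≡ ⊥
  ≡⊥ A∈ B∈ C∈ A⊏B A⊏C B≢C with ⊏⇒≡⊥∨≡⊤ A∈ B∈ A⊏B | ⊏⇒≡⊥∨≡⊤ A∈ C∈ A⊏C
  ... | inj₁ A≡⊥ | _        = A≡⊥
  ... | inj₂ _   | inj₁ A≡⊥ = A≡⊥
  ... | inj₂ B≡⊤ | inj₂ C≡⊤ = contradiction (trans B≡⊤ (sym C≡⊤)) B≢C

  butterfly-free : copies butterfly family ≡ 0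
  butterfly-free = ¬Embedding⇒free butterfly family λ {φ} e →
    let open Embedding e
        a = zero ; b = suc zero ; c = suc (suc zero) ; d = suc (suc (suc zero))
        c≢d : φ c ≢ φ d
        c≢d eq = contradiction (injective {c} {d} eq) λ ()
        2≤2 = s≤s (s≤s z≤n)
        2≤3 = s≤s (s≤s z≤n)
        0<2 = s≤s z≤n
        1<2 = s≤s (s≤s z≤n)
        φa≡⊥ = ≡⊥ (into a) (into c) (into d)
          (strict (inj₂ (0<2 , 2≤2)) λ ()) (strict (inj₂ (0<2 , 2≤3)) λ ()) c≢d
        φb≡⊥ = ≡⊥ (into b) (into c) (into d)
          (strict (inj₂ (1<2 , 2≤2)) λ ()) (strict (inj₂ (1<2 , 2≤3)) λ ()) c≢d
    in contradiction (injective {a} {b} (trans φa≡⊥ (sym φb≡⊥))) λ ()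

  diamond-copies-≥ : ∀ r → (n C k) C r ≤ copies (diamond r) family
  diamond-copies-≥ r = subst (λ N → N C r ≤ copies (diamond r) family) length-inLayer
    (Core.copies-≥ family! (diamond r) (suc ∘ inject₁) inLayer? λ {ψ} ψ-inj ψ∈ → φ ψ , record
      { injective = cons-injective
          (snoc-injective ψ ⊤ ψ-inj (λ i → ∈layer⇒≢extra (ψ∈ i) (there (here refl))))
          (snoc-all ψ ⊤ (_≢ ⊥) ⊤≢⊥ (λ i → ∈layer⇒≢extra (ψ∈ i) (here refl)))
      ; into      = λ { zero → extra∈family (here refl)
                      ; (suc i) → snoc-all ψ ⊤ (_∈ family)
                                    (extra∈family (there (here refl))) (∈layer⇒∈family ∘ ψ∈) i }
      ; monotone  = monotone ψ
      } , snoc-inject₁ ψ ⊤ , λ {x} nc → outside-layer ψ x nc)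
    where
    φ : (Fin r → Subset n) → Fin (2 + r) → Subset n
    φ ψ = ⊥ Vector.∷ snoc ψ ⊤
    ⊤≢⊥ : ⊤ ≢ ⊥
    ⊤≢⊥ e = contradiction (trans (sym (Subset.∣⊥∣≡0 n)) (trans (cong ∣_∣ (sym e)) (Subset.∣⊤∣≡n n)))
      (ℕ.<⇒≢ (ℕ.≤-trans (s≤s z≤n) k<n))
    monotone : ∀ ψ {x y} → FinPoset._≤_ (diamond r) x y → φ ψ x ⊆ φ ψ y
    monotone ψ (inj₁ refl) = id
    monotone ψ (inj₂ (inj₁ refl)) = Subset.⊥⊆
    monotone ψ {x} (inj₂ (inj₂ refl)) = subst (φ ψ x ⊆_) (sym (snoc-fromℕ ψ ⊤)) Subset.⊆⊤
    outside-layer : ∀ ψ x → (∀ i → suc (inject₁ i) ≢ x) → ¬ InLayer (φ ψ x)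
    outside-layer ψ zero    _  = extra∉layer (here refl)
    outside-layer ψ (suc x) nc = subst (λ x → ¬ InLayer (snoc ψ ⊤ x)) (sym (⋀-shape λ i e → nc i (cong suc e)))
      (subst (¬_ ∘ InLayer) (sym (snoc-fromℕ ψ ⊤)) (extra∉layer (there (here refl))))

-- P₂ as ⋀₁ and as ⋁₁

copies-cong : ∀ P Q → (∀ {n} (G : Family n) → IsCopy P G → IsCopy Q G) →
  (∀ {n} (G : Family n) → IsCopy Q G → IsCopy P G) →
  ∀ {n} (F : Family n) → copies P F ≡ copies Q F
copies-cong P Q P⇒Q Q⇒P F = cong length
  (List.filter-≐ (isCopy? P) (isCopy? Q) ((λ {G} → P⇒Q G) , (λ {G} → Q⇒P G)) (subfamilies F))

module _ {n} (G : Family n) where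

  chain⇒⋀ : IsCopy (chain 2) G → IsCopy (⋀ 1) G
  chain⇒⋀ (φ , c) = φ , record { injective = injective ; into = into ; onto = onto ; monotone = mono }
    where
    open IsCopyMap c
    mono : ∀ {x y} → FinPoset._≤_ (⋀ 1) x y → φ x ⊆ φ y
    mono (inj₁ refl) = id
    mono {x} (inj₂ refl) = monotone (Fin.≤fromℕ x)

  ⋀⇒chain : IsCopy (⋀ 1) G → IsCopy (chain 2) G
  ⋀⇒chain (φ , c) = φ , record { injective = injective ; into = into ; onto = onto ; monotone = mono }
    where
    open IsCopyMap c
    mono : ∀ {x y} → FinPoset._≤_ (chain 2) x y → φ x ⊆ φ y
    mono {zero}     {zero}     _  = id
    mono {_}        {suc zero} _  = monotone (inj₂ refl)

  chain⇒⋁ : IsCopy (chain 2) G → IsCopy (⋁ 1) G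
  chain⇒⋁ (φ , c) = φ , record { injective = injective ; into = into ; onto = onto ; monotone = mono }
    where
    open IsCopyMap c
    mono : ∀ {x y} → FinPoset._≤_ (⋁ 1) x y → φ x ⊆ φ y
    mono (inj₁ refl) = id
    mono (inj₂ refl) = monotone z≤n

  ⋁⇒chain : IsCopy (⋁ 1) G → IsCopy (chain 2) G
  ⋁⇒chain (φ , c) = φ , record { injective = injective ; into = into ; onto = onto ; monotone = mono }
    where
    open IsCopyMap c
    mono : ∀ {x y} → FinPoset._≤_ (chain 2) x y → φ x ⊆ φ y
    mono {zero}     {_}        _  = monotone (inj₂ refl)
    mono {suc zero} {suc zero} _  = id

La-cong : ∀ n 𝒫 {Q Q′} → (∀ {n} (F : Family n) → copies Q F ≡ copies Q′ F) →
  La n 𝒫 (Q ∷ []) ≡ La n 𝒫 (Q′ ∷ [])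
La-cong n 𝒫 eq = cong (max 0) (List.map-cong (λ F → cong (_+ 0) (eq F)) (freeFamilies n 𝒫))

-- Families that exclude both ⋁ and ⋀

Matching : ∀ {n} → Family n → Set
Matching F = (∀ {A B C} → A ∈ F → B ∈ F → C ∈ F → A ⊏ B → A ⊏ C → B ≡ C)
           × (∀ {A B C} → A ∈ F → B ∈ F → C ∈ F → B ⊏ A → C ⊏ A → B ≡ C)

matching-copies-≤ : ∀ {n} {F : Family n} → Unique F → Matching F →
  copies (chain 2) F ≤ (n ∸ 1) C ⌊ n ∸ 1 /2⌋
matching-copies-≤ {n} {F} F! (unique-above , unique-below) = ℕ.≤-trans
  (length-≤ SpannedBy {ys = pairs} (copiesOf-Unique (chain 2) F F!) span
    (λ G∈ G′∈ (G⇒ , G⇐) (G′⇒ , G′⇐) → ⊑-ext F! (copiesOf⇒⊑ (chain 2) F G∈) (copiesOf⇒⊑ (chain 2) F G′∈)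
      (G′⇐ ∘ G⇒) (G⇐ ∘ G′⇒)))
  (proper-intervals-≤ (Unique.filter⁺ _ (Unique.cartesianProduct⁺ F! F!))
    (λ p∈ → proj₂ (proj₂ (∈-pairs⁻ p∈))) separated)
  where
  ⊏-pair? : Decidable (λ ((A , B) : Subset n × Subset n) → A ⊏ B)
  ⊏-pair? (A , B) = A ⊏? B

  pairs : List (Subset n × Subset n)
  pairs = filter ⊏-pair? (cartesianProduct F F)

  ∈-pairs⁻ : ∀ {A B} → (A , B) ∈ pairs → A ∈ F × B ∈ F × A ⊏ B
  ∈-pairs⁻ p∈ = let p∈F×F , A⊏B = ∈-filter⁻ ⊏-pair? {xs = cartesianProduct F F} p∈
                    A∈F , B∈F = ∈-cartesianProduct⁻ F F p∈F×F
                in A∈F , B∈F , A⊏B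

  SpannedBy : Family n → Subset n × Subset n → Set
  SpannedBy G (A , B) = (∀ {X} → X ∈ G → X ≡ A ⊎ X ≡ B) × (∀ {X} → X ≡ A ⊎ X ≡ B → X ∈ G)

  span : ∀ {G} → G ∈ copiesOf (chain 2) F → ∃ λ p → p ∈ pairs × SpannedBy G p
  span {G} G∈ =
    let φ , e , c = copiesOf⇒Embedding (chain 2) F G∈
        open Embedding e
    in (φ zero , φ (suc zero)) ,
       ∈-filter⁺ ⊏-pair? (∈-cartesianProduct⁺ (into zero) (into (suc zero))) (strict z≤n λ ()) ,
       (λ X∈G → to φ (IsCopyMap.onto c X∈G)) ,
       λ { (inj₁ refl) → IsCopyMap.into c zero ; (inj₂ refl) → IsCopyMap.into c (suc zero) }
    where
    to : ∀ (φ : Fin 2 → Subset n) {X} → (∃ λ x → φ x ≡ X) → X ≡ φ zero ⊎ X ≡ φ (suc zero)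
    to φ (zero , refl)     = inj₁ refl
    to φ (suc zero , refl) = inj₂ refl

  separated : ∀ {p q} → p ∈ pairs → q ∈ pairs → proj₁ p ⊆ proj₂ q → p ≡ q
  separated {A , B} {A′ , B′} p∈ q∈ A⊆B′ with ∈-pairs⁻ p∈ | ∈-pairs⁻ q∈ | ⊆⇒⊏∨≡ A⊆B′
  -- Here A ≡ B′, and the chain A′ ⊏ A ⊏ B puts two members above A′.
  ... | A∈ , B∈ , A⊏B | A′∈ , B′∈ , A′⊏B′ | inj₂ refl =
    contradiction (unique-above A′∈ A∈ B∈ A′⊏B′ (⊏-trans A′⊏B′ A⊏B)) (proj₂ A⊏B)
  -- Both A and A′ lie below B′, and both B and B′ lie above A.
  ... | A∈ , B∈ , A⊏B | A′∈ , B′∈ , A′⊏B′ | inj₁ A⊏B′ =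
    cong₂ _,_ (unique-below B′∈ A∈ A′∈ A⊏B′ A′⊏B′) (unique-above A∈ B∈ B′∈ A⊏B A⊏B′)

-- A layer on n points times the 2-chain on one further point: each Y in the layer contributes one
-- comparable pair, Y without and with that point, and there are no others.
module DoubledLayer (n k : ℕ) where

  inDoubledLayer? : Decidable (λ (A : Subset (suc n)) → ∣ Vec.tail A ∣ ≡ k)
  inDoubledLayer? A = ∣ Vec.tail A ∣ ℕ.≟ k

  family : Family (suc n)
  family = filter inDoubledLayer? (subsets (suc n))

  -- Comparable tails of equal size coincide, so only the further point can differ.
  ⊏⇒twins : ∀ {A B} → A ∈ family → B ∈ family → A ⊏ B →
    ∃ λ Y → A ≡ outside ∷ Y × B ≡ inside ∷ Y
  ⊏⇒twins {a ∷ A} {b ∷ B} A∈ B∈ (aA⊆bB , aA≢bB)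
    with ∈-filter⁻ inDoubledLayer? {xs = subsets (suc n)} A∈
       | ∈-filter⁻ inDoubledLayer? {xs = subsets (suc n)} B∈
       | ⊆⇒⊏∨≡ {A = A} {B} (Subset.drop-∷-⊆ aA⊆bB)
  ... | _ , ∣A∣≡k | _ , ∣B∣≡k | inj₁ A⊏B = contradiction (trans ∣A∣≡k (sym ∣B∣≡k)) (ℕ.<⇒≢ (⊏⇒∣<∣ A⊏B))
  ⊏⇒twins {outside ∷ A} {inside ∷ B}  _ _ _ | _ | _ | inj₂ refl = A , refl , refl
  ⊏⇒twins {outside ∷ A} {outside ∷ B} _ _ (_ , A≢B) | _ | _ | inj₂ refl = contradiction refl A≢B
  ⊏⇒twins {inside ∷ A}  {inside ∷ B}  _ _ (_ , A≢B) | _ | _ | inj₂ refl = contradiction refl A≢B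
  ⊏⇒twins {inside ∷ A}  {outside ∷ B} _ _ (A⊆B , _) | _ | _ | inj₂ refl = contradiction (A⊆B here) λ ()

  matching : Matching family
  matching = (λ A∈ B∈ C∈ A⊏B A⊏C → above (⊏⇒twins A∈ B∈ A⊏B) (⊏⇒twins A∈ C∈ A⊏C))
           , (λ A∈ B∈ C∈ B⊏A C⊏A → below (⊏⇒twins B∈ A∈ B⊏A) (⊏⇒twins C∈ A∈ C⊏A))
    where
    above : ∀ {A B C : Subset (suc n)} → (∃ λ Y → A ≡ outside ∷ Y × B ≡ inside ∷ Y) →
            (∃ λ Y → A ≡ outside ∷ Y × C ≡ inside ∷ Y) → B ≡ C
    above (_ , refl , refl) (_ , refl , refl) = refl
    below : ∀ {A B C : Subset (suc n)} → (∃ λ Y → B ≡ outside ∷ Y × A ≡ inside ∷ Y) →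
            (∃ λ Y → C ≡ outside ∷ Y × A ≡ inside ∷ Y) → B ≡ C
    below (_ , refl , refl) (_ , refl , refl) = refl

  ⋁-free : copies (⋁ 2) family ≡ 0
  ⋁-free = ¬Embedding⇒free (⋁ 2) family λ {φ} e →
    let open Embedding e
        a = zero ; b = suc zero ; c = suc (suc zero)
    in contradiction (injective {b} {c} (proj₁ matching (into a) (into b) (into c)
         (strict (inj₂ refl) λ ()) (strict (inj₂ refl) λ ()))) λ ()

  ⋀-free : copies (⋀ 2) family ≡ 0
  ⋀-free = ¬Embedding⇒free (⋀ 2) family λ {φ} e →
    let open Embedding e
        a = zero ; b = suc zero ; c = suc (suc zero)
    in contradiction (injective {a} {b} (proj₂ matching (into c) (into a) (into b)
         (strict (inj₂ refl) λ ()) (strict (inj₂ refl) λ ()))) λ ()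

  copies-≥ : n C k ≤ copies (chain 2) family
  copies-≥ = ℕ.≤-trans (ℕ.≤-reflexive (sym (length-layer n k)))
    (length-≤ TwinsOf {ys = copiesOf (chain 2) family} (Unique.filter⁺ _ (subsets-Unique n)) twins
      (λ _ _ (Y∈G , _) (_ , G⇒Y′) → G⇒Y′ Y∈G))
    where
    TwinsOf : Subset n → Family (suc n) → Set
    TwinsOf Y G = (outside ∷ Y) ∈ G × (∀ {X} → X ∈ G → Vec.tail X ≡ Y)
    twins : ∀ {Y} → Y ∈ layer n k → ∃ λ G → G ∈ copiesOf (chain 2) family × TwinsOf Y G
    twins {Y} Y∈ = image family φ , image∈copiesOf (chain 2) family (record
        { injective = lookup-injective (((λ ()) ∷ []) ∷ [] ∷ [])
        ; into      = into
        ; monotone  = monotone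
        }) , ∈-image⁺ family φ {zero} (into zero) , λ X∈ → tail-≡ (∈-image⁻ family φ X∈)
      where
      φ : Fin 2 → Subset (suc n)
      φ = lookup ((outside ∷ Y) ∷ (inside ∷ Y) ∷ [])
      ∈family : ∀ s → (s ∷ Y) ∈ family
      ∈family s = ∈-filter⁺ inDoubledLayer? (∈-subsets (s ∷ Y))
        (proj₂ (∈-filter⁻ (ofSize? k) {xs = subsets n} Y∈))
      into : ∀ x → φ x ∈ family
      into zero       = ∈family outside
      into (suc zero) = ∈family inside
      monotone : ∀ {x y} → FinPoset._≤_ (chain 2) x y → φ x ⊆ φ y
      monotone {zero}     {zero}     _ = id
      monotone {zero}     {suc zero} _ = Subset.out⊆ id
      monotone {suc zero} {suc zero} _ = id
      tail-≡ : ∀ {X} → (∃ λ x → φ x ≡ X) → Vec.tail X ≡ Y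
      tail-≡ (zero , refl)     = refl
      tail-≡ (suc zero , refl) = refl

-- The values of `La`

0<⌊n/2⌋ : ∀ {n} → 2 ≤ n → 0 < ⌊ n /2⌋
0<⌊n/2⌋ (s≤s (s≤s _)) = s≤s z≤n

⌊n/2⌋<n : ∀ {n} → 1 ≤ n → ⌊ n /2⌋ < n
⌊n/2⌋<n {suc n} _ = ℕ.⌊n/2⌋<n n

La-⋁-⋀ : ∀ {n r} → 1 ≤ n → 1 ≤ r → La n (⋁ 2 ∷ []) (⋀ r ∷ []) ≡ (n C ⌊ n /2⌋) C r
La-⋁-⋀ {n} {r} 1≤n 1≤r = La-≡ n (⋁ 2 ∷ []) (⋀ r)
  (λ {F} F! free → ⋁-free⇒⋀-copies-≤ {F = F} F! 1≤r (All.head free))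
  (family , family-⊑ , ⋁-free ∷ [] , ⋀-copies-≥ r)
  where open LayerPlus⊤ (⌊n/2⌋<n 1≤n)

-- For n ≡ 1 the middle layer ⌊ n /2⌋ is {∅}; the layer above it is just as large.
La-⋀-⋁ : ∀ {n r} → 1 ≤ n → 1 ≤ r → La n (⋀ 2 ∷ []) (⋁ r ∷ []) ≡ (n C ⌊ n /2⌋) C r
La-⋀-⋁ {n} {r} 1≤n 1≤r = La-≡ n (⋀ 2 ∷ []) (⋁ r)
  (λ {F} F! free → ⋀-free⇒⋁-copies-≤ {F = F} F! 1≤r (All.head free))
  (family , family-⊑ , ⋀-free ∷ [] ,
    subst (λ N → N C r ≤ copies (⋁ r) family) nC⌈n/2⌉≡nC⌊n/2⌋ (⋁-copies-≥ r))
  where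
  -- `⌈ n /2⌉` unfolds to `⌊ suc n /2⌋`, which is at least `⌊ 2 /2⌋`, that is 1.
  open LayerPlus⊥ {n} {⌈ n /2⌉} (ℕ.⌊n/2⌋-mono (s≤s 1≤n))
  nC⌈n/2⌉≡nC⌊n/2⌋ : n C ⌈ n /2⌉ ≡ n C ⌊ n /2⌋
  nC⌈n/2⌉≡nC⌊n/2⌋ = trans (nCk≡nC[n∸k] (ℕ.⌈n/2⌉≤n n)) (cong (n C_)
    (trans (cong (_∸ ⌈ n /2⌉) (sym (ℕ.⌊n/2⌋+⌈n/2⌉≡n n))) (ℕ.m+n∸n≡m ⌊ n /2⌋ ⌈ n /2⌉)))

La-⋁⋀-chain : ∀ {n} → 1 ≤ n → La n (⋁ 2 ∷ ⋀ 2 ∷ []) (chain 2 ∷ []) ≡ (n ∸ 1) C ⌊ n ∸ 1 /2⌋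
La-⋁⋀-chain {suc n} _ = La-≡ (suc n) (⋁ 2 ∷ ⋀ 2 ∷ []) (chain 2)
  (λ {F} F! free → matching-copies-≤ F!
    (⋁-free⇒unique-above {F = F} (All.head free) , ⋀-free⇒unique-below {F = F} (All.head (All.tail free))))
  (family , Sublist.filter-⊆ inDoubledLayer? (subsets (suc n)) , ⋁-free ∷ ⋀-free ∷ [] , copies-≥)
  where open DoubledLayer n ⌊ n /2⌋

-- For n ≡ r ≡ 1 the equality fails: D₁ has three elements but [1] has only two subsets, so there
-- are no copies, while the right-hand side is 1.
La-butterfly-diamond : ∀ {n r} → 1 ≤ n → 1 ≤ r → ¬ (n ≡ 1 × r ≡ 1) →
  La n (butterfly ∷ []) (diamond r ∷ []) ≡ (n C ⌊ n /2⌋) C r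
La-butterfly-diamond {n} {suc r} 1≤n _ n≢1∨r≢1 = La-≡ n (butterfly ∷ []) (diamond (suc r))
  (λ {F} F! free → Diamond.diamond-copies-≤ F! (butterfly-free⇒≡ {F = F} (All.head free)) r)
  (lower n r 1≤n n≢1∨r≢1)
  where
  lower : ∀ n r → 1 ≤ n → ¬ (n ≡ 1 × suc r ≡ 1) → ∃ λ F → F ⊑ subsets n ×
    All (λ P → copies P F ≡ 0) (butterfly ∷ []) × (n C ⌊ n /2⌋) C suc r ≤ copies (diamond (suc r)) F
  lower (suc zero)    zero    _ ¬11 = contradiction (refl , refl) ¬11
  -- Here n C ⌊ n /2⌋ ≡ 1 < r, so the bound is 0.
  lower (suc zero)    (suc r) _ _   = [] , Sublist.minimum (subsets 1) ,
    ¬Embedding⇒free butterfly {1} [] (λ e → contradiction (Embedding.into e zero) λ ()) ∷ [] , z≤n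
  -- From two points on, the middle layer contains neither ∅ nor the full set.
  lower (suc (suc n)) r       1≤n _ = family , family-⊑ , butterfly-free ∷ [] , diamond-copies-≥ (suc r)
    where open LayerPlus⊥⊤ {suc (suc n)} (0<⌊n/2⌋ (s≤s (s≤s z≤n))) (⌊n/2⌋<n 1≤n)

theorem1p3 : (n r : ℕ) → 1 ≤ n → 1 ≤ r →
    (La n [ ⋁ 2 ] [ chain 2 ] ≡ n C ⌊ n /2⌋ × La n [ ⋀ 2 ] [ chain 2 ] ≡ n C ⌊ n /2⌋)
    × (La n (⋁ 2 ∷ ⋀ 2 ∷ []) [ chain 2 ] ≡ (n ∸ 1) C ⌊ n ∸ 1 /2⌋)
    × (¬ (n ≡ 1 × r ≡ 1) → La n [ butterfly ] [ diamond r ] ≡ (n C ⌊ n /2⌋) C r)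
    × (La n [ ⋁ 2 ] [ ⋀ r ] ≡ (n C ⌊ n /2⌋) C r × La n [ ⋀ 2 ] [ ⋁ r ] ≡ (n C ⌊ n /2⌋) C r)
theorem1p3 n r 1≤n 1≤r =
    ( trans (La-cong n (⋁ 2 ∷ []) (copies-cong (chain 2) (⋀ 1) chain⇒⋀ ⋀⇒chain))
        (trans (La-⋁-⋀ 1≤n ℕ.≤-refl) (nC1≡n _))
    , trans (La-cong n (⋀ 2 ∷ []) (copies-cong (chain 2) (⋁ 1) chain⇒⋁ ⋁⇒chain))
        (trans (La-⋀-⋁ 1≤n ℕ.≤-refl) (nC1≡n _)))
  , La-⋁⋀-chain 1≤n
  , La-butterfly-diamond 1≤n 1≤r
  , La-⋁-⋀ 1≤n 1≤r
  , La-⋀-⋁ 1≤n 1≤r
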